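{- Let $\mathbf F$ be a satisfiable $k$-CNF formula on $n$ variables. There exists a deterministic algorithm that, given $\mathbf F$, uses $O^*(2^n)$ time and $O^*(2^n)$ space and outputs a pair of satisfying assignments $z_1,z_2\in\Omega_{\mathbf F}$ with $d_H(z_1,z_2)=\mathrm{Diam}(\mathbf F)$.
   Context: $\Omega_{\mathbf F}\subseteq\{0,1\}^n$ is the set of satisfying assignments of $\mathbf F$; $d_H$ is Hamming distance; $\mathrm{Diam}(\mathbf F)=\max_{z_1,z_2\in\Omega_{\mathbf F}} d_H(z_1,z_2)$ (so it is $0$ if there is a unique satisfying assignment). A $k$-CNF formula is a conjunction of clauses, each a disjunction of at most $k$ literals; formulas have $n^{O(1)}$ clauses. $O^*$ hides factors polynomial in $n$. -}

module Defs where

open import Data.Bool.Base using (Bool; true; false; if_then_else_)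
open import Data.Bool.Properties using () renaming (_≟_ to _≟ᵇ_)
open import Data.Fin.Base using (Fin; toℕ)
open import Data.List.Base
  using (List; []; _∷_; _++_; length; map; concatMap; take; filter;
         cartesianProductWith)
open import Data.List.Extrema.Nat using (max)
open import Data.List.Membership.Propositional using (_∈_)
open import Data.List.Membership.Propositional.Properties
  using (∈-cartesianProductWith⁺; ∈-filter⁺; ∈-filter⁻)
open import Data.List.Relation.Unary.All as All using (All)
open import Data.List.Relation.Unary.Any as Any using (Any; here; there)
open import Data.Nat.Base
  using (ℕ; zero; suc; _+_; _*_; _^_; _∸_; _⊔_; _≤_; ⌊_/2⌋)
open import Data.Nat.ListAction using (sum)
open import Data.Nat.Logarithm using (⌊log₂_⌋)
open import Data.Product.Base using (_×_; _,_; proj₂; ∃-syntax)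
open import Data.Vec.Base as Vec using (Vec)
open import Function.Base using (_∘_)
open import Function.Bundles using (_⇔_; mk⇔)
open import Relation.Binary.PropositionalEquality.Core
  using (_≡_; _≢_; refl)
open import Relation.Nullary.Decidable.Core using (¬?)
open import Relation.Nullary.Negation.Core using (contradiction)
open import Relation.Unary using (Decidable)

private
  variable
    n r : ℕ

------------------------------------------------------------------------
-- CNF formulas

Assignment : ℕ → Set
Assignment = Vec Bool

-- The literal xᵢ has sign true, its negation has sign false.
record Literal (n : ℕ) : Set where
  constructor literal
  field
    var  : Fin n
    sign : Bool

open Literal public

Clause : ℕ → Set
Clause n = List (Literal n)

CNF : ℕ → Set
CNF n = List (Clause n)

IsKCNF : ℕ → CNF n → Set
IsKCNF k = All (λ C → length C ≤ k)

_⊨ˡ_ : Assignment n → Literal n → Set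
z ⊨ˡ ℓ = Vec.lookup z (var ℓ) ≡ sign ℓ

_⊨ᶜ_ : Assignment n → Clause n → Set
z ⊨ᶜ C = Any (z ⊨ˡ_) C

_⊨_ : Assignment n → CNF n → Set
z ⊨ F = All (z ⊨ᶜ_) F

Satisfiable : CNF n → Set
Satisfiable F = ∃[ z ] z ⊨ F

_⊨?_ : (F : CNF n) → Decidable (_⊨ F)
_⊨?_ F z = All.all? (Any.any? (λ ℓ → Vec.lookup z (var ℓ) ≟ᵇ sign ℓ)) F

assignments : ∀ n → List (Assignment n)
assignments zero    = Vec.[] ∷ []
assignments (suc n) =
  cartesianProductWith Vec._∷_ (false ∷ true ∷ []) (assignments n)

Ω : CNF n → List (Assignment n)
Ω {n} F = filter (F ⊨?_) (assignments n)

∈-assignments : (z : Assignment n) → z ∈ assignments n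
∈-assignments Vec.[]      = here refl
∈-assignments (b Vec.∷ z) =
  ∈-cartesianProductWith⁺ Vec._∷_ (∈-bools b) (∈-assignments z)
  where
  ∈-bools : ∀ b → b ∈ false ∷ true ∷ []
  ∈-bools false = here refl
  ∈-bools true  = there (here refl)

∈Ω⇔⊨ : (F : CNF n) (z : Assignment n) → z ∈ Ω F ⇔ z ⊨ F
∈Ω⇔⊨ F z = mk⇔ (proj₂ ∘ ∈-filter⁻ (F ⊨?_) {xs = assignments _})
               (∈-filter⁺ (F ⊨?_) (∈-assignments z))

------------------------------------------------------------------------
-- Diameter

d_H : Assignment n → Assignment n → ℕ
d_H x y = Vec.count (λ (a , b) → ¬? (a ≟ᵇ b)) (Vec.zip x y)

-- For unsatisfiable F the maximum is over an empty family, and the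
-- default value 0 is returned.
Diam : CNF n → ℕ
Diam F = max 0 (cartesianProductWith d_H (Ω F) (Ω F))

------------------------------------------------------------------------
-- Random access machine with logarithmic costs
--
-- A program has a fixed number r of registers and an unbounded memory,
-- both holding natural numbers.  Only the touched prefix of the memory is
-- stored in the state: cells beyond it read as 0, and a write beyond it
-- extends it (and pays, in space, for every cell in between).

record State (r : ℕ) : Set where
  constructor ⟪_,_⟫
  field
    regs : Vec ℕ r
    mem  : List ℕ

open State public

read : List ℕ → ℕ → ℕ
read []       _       = 0
read (v ∷ vs) zero    = v
read (v ∷ vs) (suc i) = read vs i

write : List ℕ → ℕ → ℕ → List ℕ
write []       zero    w = w ∷ []
write []       (suc i) w = 0 ∷ write [] i w
write (v ∷ vs) zero    w = w ∷ vs
write (v ∷ vs) (suc i) w = v ∷ write vs i w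

Reg : ℕ → Set
Reg = Fin

data Instr (r : ℕ) : Set where
  const : (x : Reg r) (c : ℕ)   → Instr r   -- x ← c
  add   : (x y z : Reg r)       → Instr r   -- x ← y + z
  sub   : (x y z : Reg r)       → Instr r   -- x ← y ∸ z
  half  : (x y : Reg r)         → Instr r   -- x ← ⌊ y /2⌋
  load  : (x y : Reg r)         → Instr r   -- x ← mem[y]
  store : (x y : Reg r)         → Instr r   -- mem[x] ← y

get : State r → Reg r → ℕ
get s x = Vec.lookup (regs s) x

set : State r → Reg r → ℕ → State r
set s x v = ⟪ regs s Vec.[ x ]≔ v , mem s ⟫

exec : Instr r → State r → State r
exec (const x c) s = set s x c
exec (add x y z) s = set s x (get s y + get s z)
exec (sub x y z) s = set s x (get s y ∸ get s z)
exec (half x y)  s = set s x ⌊ get s y /2⌋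
exec (load x y)  s = set s x (read (mem s) (get s y))
exec (store x y) s = ⟪ regs s , write (mem s) (get s x) (get s y) ⟫

-- Length of the binary representation, with bits 0 = 1.
bits : ℕ → ℕ
bits v = suc ⌊log₂ v ⌋

cost : Instr r → State r → ℕ
cost (const x c) s = bits c
cost (add x y z) s = bits (get s y) + bits (get s z)
cost (sub x y z) s = bits (get s y) + bits (get s z)
cost (half x y)  s = bits (get s y)
cost (load x y)  s = bits (get s y) + bits (read (mem s) (get s y))
cost (store x y) s = bits (get s x) + bits (get s y)

space : State r → ℕ
space s = Vec.sum (Vec.map bits (regs s)) + sum (map bits (mem s))

infixr 5 _⨾_

data Cmd (r : ℕ) : Set where
  skip    : Cmd r
  instr   : Instr r → Cmd r
  _⨾_     : Cmd r → Cmd r → Cmd r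
  ifnz    : Reg r → Cmd r → Cmd r → Cmd r
  whilenz : Reg r → Cmd r → Cmd r

-- ⟨ c , s ⟩⇓⟨ s′ , t , p ⟩: started in s, the command c halts in s′ after
-- time t, and p is the maximal space of a state visited on the way.
data ⟨_,_⟩⇓⟨_,_,_⟩ {r} : Cmd r → State r → State r → ℕ → ℕ → Set where

  ⇓skip : ∀ {s} → ⟨ skip , s ⟩⇓⟨ s , 1 , space s ⟩

  ⇓instr : ∀ {i s} →
    ⟨ instr i , s ⟩⇓⟨ exec i s , cost i s , space s ⊔ space (exec i s) ⟩

  ⇓seq : ∀ {c d s s′ s″ t u p q} →
    ⟨ c , s ⟩⇓⟨ s′ , t , p ⟩ → ⟨ d , s′ ⟩⇓⟨ s″ , u , q ⟩ →
    ⟨ c ⨾ d , s ⟩⇓⟨ s″ , t + u , p ⊔ q ⟩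

  ⇓ifnz-then : ∀ {x c d s s′ t p} → get s x ≢ 0 →
    ⟨ c , s ⟩⇓⟨ s′ , t , p ⟩ →
    ⟨ ifnz x c d , s ⟩⇓⟨ s′ , bits (get s x) + t , p ⟩

  ⇓ifnz-else : ∀ {x c d s s′ t p} → get s x ≡ 0 →
    ⟨ d , s ⟩⇓⟨ s′ , t , p ⟩ →
    ⟨ ifnz x c d , s ⟩⇓⟨ s′ , bits (get s x) + t , p ⟩

  ⇓whilenz-stop : ∀ {x c s} → get s x ≡ 0 →
    ⟨ whilenz x c , s ⟩⇓⟨ s , bits (get s x) , space s ⟩

  ⇓whilenz-step : ∀ {x c s s′ s″ t u p q} → get s x ≢ 0 →
    ⟨ c , s ⟩⇓⟨ s′ , t , p ⟩ → ⟨ whilenz x c , s′ ⟩⇓⟨ s″ , u , q ⟩ →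
    ⟨ whilenz x c , s ⟩⇓⟨ s″ , bits (get s x) + (t + u) , p ⊔ q ⟩

⇓-deterministic : ∀ {c : Cmd r} {s s₁ s₂ t₁ t₂ p₁ p₂} →
  ⟨ c , s ⟩⇓⟨ s₁ , t₁ , p₁ ⟩ → ⟨ c , s ⟩⇓⟨ s₂ , t₂ , p₂ ⟩ →
  (s₁ ≡ s₂) × (t₁ ≡ t₂) × (p₁ ≡ p₂)
⇓-deterministic ⇓skip  ⇓skip  = refl , refl , refl
⇓-deterministic ⇓instr ⇓instr = refl , refl , refl
⇓-deterministic (⇓seq a b) (⇓seq a′ b′)
  with refl , refl , refl ← ⇓-deterministic a a′
  with refl , refl , refl ← ⇓-deterministic b b′ = refl , refl , refl
⇓-deterministic (⇓ifnz-then _ a) (⇓ifnz-then _ a′)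
  with refl , refl , refl ← ⇓-deterministic a a′ = refl , refl , refl
⇓-deterministic (⇓ifnz-then x≢0 _) (⇓ifnz-else x≡0 _) = contradiction x≡0 x≢0
⇓-deterministic (⇓ifnz-else x≡0 _) (⇓ifnz-then x≢0 _) = contradiction x≡0 x≢0
⇓-deterministic (⇓ifnz-else _ a) (⇓ifnz-else _ a′)
  with refl , refl , refl ← ⇓-deterministic a a′ = refl , refl , refl
⇓-deterministic (⇓whilenz-stop _) (⇓whilenz-stop _) = refl , refl , refl
⇓-deterministic (⇓whilenz-stop x≡0) (⇓whilenz-step x≢0 _ _) =
  contradiction x≡0 x≢0
⇓-deterministic (⇓whilenz-step x≢0 _ _) (⇓whilenz-stop x≡0) =
  contradiction x≡0 x≢0
⇓-deterministic (⇓whilenz-step _ a b) (⇓whilenz-step _ a′ b′)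
  with refl , refl , refl ← ⇓-deterministic a a′
  with refl , refl , refl ← ⇓-deterministic b b′ = refl , refl , refl

record Program : Set where
  constructor program
  field
    registers : ℕ
    body      : Cmd registers

open Program public

-- Input and output are length-prefixed arrays at address 0; registers
-- start at 0.
initial : List ℕ → State r
initial xs = ⟪ Vec.replicate _ 0 , length xs ∷ xs ⟫

output : State r → List ℕ
output s with mem s
... | []     = []
... | l ∷ vs = take l vs

-- On input xs, the program halts with output ys after time t, having used
-- space p.
Runs : Program → List ℕ → List ℕ → ℕ → ℕ → Set
Runs P xs ys t p =
  ∃[ s ] ⟨ body P , initial xs ⟩⇓⟨ s , t , p ⟩ × output s ≡ ys

------------------------------------------------------------------------
-- Encodings

bit : Bool → ℕ
bit b = if b then 1 else 0

encodeLiteral : Literal n → List ℕ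
encodeLiteral ℓ = toℕ (var ℓ) ∷ bit (sign ℓ) ∷ []

encodeClause : Clause n → List ℕ
encodeClause C = length C ∷ concatMap encodeLiteral C

encodeCNF : CNF n → List ℕ
encodeCNF {n} F = n ∷ concatMap encodeClause F

encodeAssignment : Assignment n → List ℕ
encodeAssignment z = Vec.toList (Vec.map bit z)

encodePair : Assignment n → Assignment n → List ℕ
encodePair z₁ z₂ = encodeAssignment z₁ ++ encodeAssignment z₂

------------------------------------------------------------------------
-- Growth rates

-- f n = n^O(1).  The base suc n rather than n keeps the bound meaningful
-- for n = 0 and n = 1.
PolyBounded : (ℕ → ℕ) → Set
PolyBounded f = ∃[ c ] ∀ n → f n ≤ c * suc n ^ c

_∈O*_ : (ℕ → ℕ) → (ℕ → ℕ) → Set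
f ∈O* g = ∃[ q ] PolyBounded q × (∀ n → f n ≤ q n * g n)

{-# OPTIONS --safe #-}

-- Give x ∈ Ω the value 2ⁿ + x, reading x as a binary number, and every other
-- x the value 0.  For one variable at a time, replace the value at x by its
-- maximum with the value at the neighbour of x along that variable, raised
-- by 2ⁿ if it is nonzero.  After all n variables the value at x is
--   max { (1 + d_H x z) · 2ⁿ + z ∣ z ∈ Ω },
-- and since z < 2ⁿ its low n bits are a point of Ω farthest from x.  The
-- largest such value over x ∈ Ω therefore yields a diametral pair.  Each of
-- the n layers is a table of 2ⁿ numbers of O(n) bits.

module Submission where

open import Defs
open import Data.Bool.Base using (Bool; true; false; not; T)
open import Data.Empty using (⊥)
open import Data.Fin using (#_)
open import Data.Fin.Base using (Fin; zero; suc; toℕ)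
open import Data.Fin.Properties using (toℕ<n)
open import Data.List.Base
  using (List; []; _∷_; _++_; _∷ʳ_; length; map; take; drop; concatMap)
open import Data.List.Extrema.Nat using (max≤v⁺; v≤max⁺)
open import Data.List.Membership.Propositional using (_∈_)
open import Data.List.Membership.Propositional.Properties
  using (∈-cartesianProductWith⁺; ∈-cartesianProductWith⁻)
open import Data.List.Properties
  using (++-assoc; ++-identityʳ; length-++; length-map; length-take; length-drop;
         map-++; map-∘; take++drop≡id; ∷-injective)
open import Data.List.Relation.Unary.All as All using (All; []; _∷_)
open import Data.List.Relation.Unary.All.Properties using (++⁻ˡ; ++⁺; take⁺; drop⁺; map⁺)
open import Data.List.Relation.Unary.Any as Any using (here; there)
open import Data.Nat.Base
open import Data.Nat.ListAction using (sum)
open import Data.Nat.Logarithm using (⌊log₂⌋-mono-≤; ⌊log₂[2^n]⌋≡n)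
open import Data.Nat.Properties
open import Data.Nat.Tactic.RingSolver using (solve-∀)
open import Data.Product.Base using (_×_; _,_; Σ-syntax; ∃-syntax; proj₁; proj₂)
open import Data.Sum.Base using (_⊎_; inj₁; inj₂)
open import Data.Unit.Base using (⊤; tt)
open import Data.Vec.Base as Vec using (Vec; []; _∷_)
open import Data.Vec.Properties using (length-toList)
open import Data.Vec.Relation.Unary.All as VecAll using ([]; _∷_) renaming (All to VecAll)
open import Data.Vec.Relation.Unary.All.Properties using (lookup⁺)
open import Function.Bundles using (Equivalence)
open import Relation.Binary.PropositionalEquality
open import Relation.Nullary.Negation.Core using (¬_; contradiction)

-- Comparing all pairs in `Ω` costs up to 4ⁿ. The layers share this work among all points `x`; they
-- are the max-plus analogue of the Walsh-Hadamard transform, with `d_H` as kernel. Carrying `z` in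
-- the low bits lets the witness travel with the maximum, so no table of pointers is kept. The
-- offset 2ⁿ leaves 0 free to mean that there is no candidate, also when `z` is the number 0. The
-- machine charges by the length of the numbers, so every bound on time or space needs a bound on
-- all numbers in the state. Invariants carry such bounds only at the entries of loops and loop-free
-- commands; inside a loop-free command the numbers are controlled by its length. Loops are treated
-- by induction on their counters, loop-free commands by a symbolic evaluator. The functions on the
-- mathematical side (`literalVal`, `bump`, `_⊕_`, `lowBit`, `count`, `up`) use the very additions,
-- truncated subtractions and halvings of the program, so that evaluation mostly yields them by
-- computation alone.

private
  variable
    n r : ℕ

-- Bounded machine states

bits-mono : ∀ {a b} → a ≤ b → bits a ≤ bits b
bits-mono a≤b = s≤s (⌊log₂⌋-mono-≤ a≤b)

-- One `V` serves for values and for the length of the memory: addresses are register values, so a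
-- bound on the registers also limits how far a store can extend the memory.
record Bounded (V : ℕ) (s : State r) : Set where
  constructor bounded
  field
    regs≤   : VecAll (_≤ V) (regs s)
    mem≤    : All (_≤ V) (mem s)
    length≤ : length (mem s) ≤ V

  get≤ : ∀ x → get s x ≤ V
  get≤ = lookup⁺ regs≤

open Bounded

Bounded-mono : ∀ {V V′} {s : State r} → V ≤ V′ → Bounded V s → Bounded V′ s
Bounded-mono V≤V′ (bounded p q l) =
  bounded (VecAll.map (λ v → ≤-trans v V≤V′) p)
          (All.map (λ v → ≤-trans v V≤V′) q) (≤-trans l V≤V′)

read≤ : ∀ {V m} i → All (_≤ V) m → read m i ≤ V
read≤ i       []       = z≤n
read≤ zero    (v ∷ vs) = v
read≤ (suc i) (v ∷ vs) = read≤ i vs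

write≤ : ∀ {V w m} i → w ≤ V → All (_≤ V) m → All (_≤ V) (write m i w)
write≤ zero    w≤V []       = w≤V ∷ []
write≤ (suc i) w≤V []       = z≤n ∷ write≤ i w≤V []
write≤ zero    w≤V (v ∷ vs) = w≤V ∷ vs
write≤ (suc i) w≤V (v ∷ vs) = v ∷ write≤ i w≤V vs

length-write≤ : ∀ {L} m i w → i < L → length m ≤ L → length (write m i w) ≤ L
length-write≤ []       zero    w i<L     m≤L       = i<L
length-write≤ []       (suc i) w (s≤s p) m≤L       = s≤s (length-write≤ [] i w p z≤n)
length-write≤ (v ∷ vs) zero    w i<L     m≤L       = m≤L
length-write≤ (v ∷ vs) (suc i) w (s≤s p) (s≤s m≤L) = s≤s (length-write≤ vs i w p m≤L)

space≤ : ∀ {W} {s : State r} → Bounded W s → space s ≤ (r + W) * bits W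
space≤ {r} {W} {s} (bounded p q l) = begin
  Vec.sum (Vec.map bits (regs s)) + sum (map bits (mem s))
    ≤⟨ +-mono-≤ (regs-sum p) (mem-sum q) ⟩
  r * bits W + length (mem s) * bits W
    ≤⟨ +-monoʳ-≤ (r * bits W) (*-monoˡ-≤ (bits W) l) ⟩
  r * bits W + W * bits W
    ≡⟨ *-distribʳ-+ (bits W) r W ⟨
  (r + W) * bits W ∎
  where
  open ≤-Reasoning
  regs-sum : ∀ {k} {xs : Vec ℕ k} → VecAll (_≤ W) xs → Vec.sum (Vec.map bits xs) ≤ k * bits W
  regs-sum []       = z≤n
  regs-sum (v ∷ vs) = +-mono-≤ (bits-mono v) (regs-sum vs)
  mem-sum : ∀ {xs} → All (_≤ W) xs → sum (map bits xs) ≤ length xs * bits W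
  mem-sum []       = z≤n
  mem-sum (v ∷ vs) = +-mono-≤ (bits-mono v) (mem-sum vs)

-- Loop-free commands

-- Constants up to 2 are all that the program uses, and they respect every bound `V` with `2 ≤ V`.
Straight : Cmd r → Set
Straight skip                = ⊤
Straight (instr (const x c)) = T (c ≤ᵇ 2)
Straight (instr _)           = ⊤
Straight (c ⨾ d)             = Straight c × Straight d
Straight (ifnz x c d)        = Straight c × Straight d
Straight (whilenz x c)       = ⊥

size : Cmd r → ℕ
size skip          = 1
size (instr i)     = 1
size (c ⨾ d)       = size c + size d
size (ifnz x c d)  = suc (size c + size d)
size (whilenz x c) = 1

branch : ℕ → State r → State r → State r
branch zero    s s′ = s′
branch (suc _) s s′ = s

-- The final state as a function instead of a relation: on states with explicit registers Agda
-- computes it, and most blocks of the program then need no argument about their effect.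
eval : Cmd r → State r → State r
eval skip          s = s
eval (instr i)     s = exec i s
eval (c ⨾ d)       s = eval d (eval c s)
eval (ifnz x c d)  s = branch (get s x) (eval c s) (eval d s)
eval (whilenz x c) s = s

update≤ : ∀ {V v k} {xs : Vec ℕ k} (x : Fin k) →
  v ≤ V → VecAll (_≤ V) xs → VecAll (_≤ V) (xs Vec.[ x ]≔ v)
update≤ zero    v≤V (p ∷ ps) = v≤V ∷ ps
update≤ (suc x) v≤V (p ∷ ps) = p ∷ update≤ x v≤V ps

V≤2*V : ∀ V → V ≤ 2 * V
V≤2*V V = m≤m+n V (V + 0)

+≤2* : ∀ {V a b} → a ≤ V → b ≤ V → a + b ≤ 2 * V
+≤2* {V} a≤V b≤V = +-mono-≤ a≤V (≤-trans b≤V (m≤m+n V 0))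

-- One instruction at most doubles the largest number in the state, so
-- that bounds are only needed at the entry of a loop-free command.
exec-Bounded : ∀ {V} {s : State r} i → Straight (instr i) → 2 ≤ V →
  Bounded V s → Bounded (2 * V) (exec i s)
exec-Bounded {V = V} {s} i ok 2≤V B = go i ok
  where
  B₂ = Bounded-mono (V≤2*V V) B
  set-Bounded : ∀ x {v} → v ≤ 2 * V → Bounded (2 * V) (set s x v)
  set-Bounded x v≤ = bounded (update≤ x v≤ (regs≤ B₂)) (mem≤ B₂) (length≤ B₂)
  go : ∀ i → Straight (instr i) → Bounded (2 * V) (exec i s)
  go (const x c) ok = set-Bounded x (≤-trans (≤ᵇ⇒≤ c 2 ok) (≤-trans 2≤V (V≤2*V V)))
  go (add x y z) _  = set-Bounded x (+≤2* (get≤ B y) (get≤ B z))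
  go (sub x y z) _  = set-Bounded x (≤-trans (m∸n≤m _ (get s z)) (get≤ B₂ y))
  go (half x y)  _  = set-Bounded x (≤-trans (⌊n/2⌋≤n _) (get≤ B₂ y))
  go (load x y)  _  = set-Bounded x (read≤ (get s y) (mem≤ B₂))
  go (store x y) _  = bounded (regs≤ B₂) (write≤ (get s x) (get≤ B₂ y) (mem≤ B₂))
    (length-write≤ (mem s) (get s x) (get s y)
      (<-≤-trans (s≤s (get≤ B x)) (+≤2* (≤-trans (s≤s z≤n) 2≤V) ≤-refl)) (length≤ B₂))

pow-split : ∀ a b V → 2 ^ b * (2 ^ a * V) ≡ 2 ^ (a + b) * V
pow-split a b V = begin
  2 ^ b * (2 ^ a * V)  ≡⟨ *-assoc (2 ^ b) (2 ^ a) V ⟨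
  2 ^ b * 2 ^ a * V    ≡⟨ cong (_* V) (^-distribˡ-+-* 2 b a) ⟨
  2 ^ (b + a) * V      ≡⟨ cong (λ e → 2 ^ e * V) (+-comm b a) ⟩
  2 ^ (a + b) * V      ∎
  where open ≡-Reasoning

pow-mono : ∀ {a b} V → a ≤ b → 2 ^ a * V ≤ 2 ^ b * V
pow-mono V a≤b = *-monoˡ-≤ V (^-monoʳ-≤ 2 a≤b)

V≤2^*V : ∀ a V → V ≤ 2 ^ a * V
V≤2^*V a V = ≤-trans (≤-reflexive (sym (+-identityʳ V))) (pow-mono {0} {a} V z≤n)

branch-elim : ∀ (P : State r → Set) v {s s′} → P s → P s′ → P (branch v s s′)
branch-elim P zero    p p′ = p′
branch-elim P (suc _) p p′ = p

eval-Bounded : ∀ {V} {s : State r} c → Straight c → 2 ≤ V →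
  Bounded V s → Bounded (2 ^ size c * V) (eval c s)
eval-Bounded skip ok 2≤V B = Bounded-mono (V≤2*V _) B
eval-Bounded (instr i) ok 2≤V B = exec-Bounded i ok 2≤V B
eval-Bounded {V = V} {s} (c ⨾ d) (ok , ok′) 2≤V B =
  subst (λ V′ → Bounded V′ (eval d (eval c s))) (pow-split (size c) (size d) V)
    (eval-Bounded d ok′ (≤-trans 2≤V (V≤2^*V (size c) V)) (eval-Bounded c ok 2≤V B))
eval-Bounded {V = V} {s} (ifnz x c d) (ok , ok′) 2≤V B =
  branch-elim (Bounded _) (get s x)
    (Bounded-mono (pow-mono V (m≤n⇒m≤1+n (m≤m+n (size c) (size d)))) (eval-Bounded c ok 2≤V B))
    (Bounded-mono (pow-mono V (m≤n⇒m≤1+n (m≤n+m (size d) (size c)))) (eval-Bounded d ok′ 2≤V B))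

cost≤ : ∀ {W} {s : State r} i → Straight (instr i) → 2 ≤ W → Bounded W s → cost i s ≤ 2 * bits W
cost≤ {W = W} {s} i ok 2≤W B = go i ok
  where
  one : ∀ {a} → a ≤ W → bits a ≤ 2 * bits W
  one a≤W = ≤-trans (bits-mono a≤W) (V≤2*V (bits W))
  two : ∀ {a b} → a ≤ W → b ≤ W → bits a + bits b ≤ 2 * bits W
  two a≤W b≤W = +≤2* (bits-mono a≤W) (bits-mono b≤W)
  go : ∀ i → Straight (instr i) → cost i s ≤ 2 * bits W
  go (const x c) ok = one (≤-trans (≤ᵇ⇒≤ c 2 ok) 2≤W)
  go (add x y z) _  = two (get≤ B y) (get≤ B z)
  go (sub x y z) _  = two (get≤ B y) (get≤ B z)
  go (half x y)  _  = one (get≤ B y)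
  go (load x y)  _  = two (get≤ B y) (read≤ (get s y) (mem≤ B))
  go (store x y) _  = two (get≤ B x) (get≤ B y)

-- The cost of a loop of `c` rounds of cost `N`, when each of the `c + 1` tests of its condition
-- costs one unit.
loopSteps : ℕ → ℕ → ℕ
loopSteps N zero    = 1
loopSteps N (suc c) = suc N + loopSteps N c

loopSteps-mono : ∀ {N M c d} → N ≤ M → c ≤ d → loopSteps N c ≤ loopSteps M d
loopSteps-mono {d = zero}  N≤M z≤n       = ≤-refl
loopSteps-mono {d = suc d} N≤M z≤n       = s≤s z≤n
loopSteps-mono             N≤M (s≤s c≤d) = +-mono-≤ (s≤s N≤M) (loopSteps-mono N≤M c≤d)

-- V bounds the numbers at the entry of a loop-free command of at most ℓ
-- instructions, W those on the way.
module Exec (ℓ V : ℕ) (2≤V : 2 ≤ V) where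

  W : ℕ
  W = 2 ^ ℓ * V

  β : ℕ
  β = 2 * bits W

  σ : ℕ → ℕ
  σ r = (r + W) * bits W

  -- The exact time and peak are hidden. Time is measured in units of `β`, which dominates the cost
  -- of any single instruction or test, so that runs compose by adding their `N`.
  record Run (c : Cmd r) (s s′ : State r) (N : ℕ) : Set where
    constructor run
    field
      {time peak} : ℕ
      derivation  : ⟨ c , s ⟩⇓⟨ s′ , time , peak ⟩
      time≤       : time ≤ N * β
      peak≤       : peak ≤ σ r

  V≤W : V ≤ W
  V≤W = V≤2^*V ℓ V

  2≤W : 2 ≤ W
  2≤W = ≤-trans 2≤V V≤W

  bits≤β : ∀ {a} → a ≤ W → bits a ≤ β
  bits≤β a≤W = ≤-trans (bits-mono a≤W) (V≤2*V (bits W))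

  -- The second part of a sequence is entered with a larger bound than the first, so the entry bound
  -- `U` varies in the induction, while all costs are charged at the fixed `W`. The inequality
  -- `2 ^ size c * U ≤ W` says that enough doublings are left.
  run-straight′ : ∀ {U} {s : State r} c → Straight c → 2 ≤ U → Bounded U s →
    2 ^ size c * U ≤ W → Run c s (eval c s) (size c)
  run-straight′ {U = U} skip ok 2≤U B U≤W =
    run ⇓skip (≤-trans (s≤s z≤n) (m≤m+n β 0))
      (space≤ (Bounded-mono (≤-trans (V≤2*V U) U≤W) B))
  run-straight′ {U = U} {s} (instr i) ok 2≤U B U≤W =
    run ⇓instr (≤-trans (cost≤ i ok 2≤W B′) (m≤m+n β 0))
      (⊔-lub (space≤ B′) (space≤ (Bounded-mono U≤W (exec-Bounded i ok 2≤U B))))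
    where B′ = Bounded-mono (≤-trans (V≤2*V U) U≤W) B
  run-straight′ {U = U} {s} (c ⨾ d) (ok , ok′) 2≤U B U≤W
    with run D t≤ p≤ ← run-straight′ c ok 2≤U B
                         (≤-trans (pow-mono U (m≤m+n (size c) (size d))) U≤W)
    with run D′ t≤′ p≤′ ← run-straight′ d ok′ (≤-trans 2≤U (V≤2^*V (size c) U))
                            (eval-Bounded c ok 2≤U B)
                            (≤-trans (≤-reflexive (pow-split (size c) (size d) U)) U≤W)
    = run (⇓seq D D′)
        (≤-trans (+-mono-≤ t≤ t≤′) (≤-reflexive (sym (*-distribʳ-+ β (size c) (size d)))))
        (⊔-lub p≤ p≤′)
  run-straight′ {U = U} {s} (ifnz x c d) (ok , ok′) 2≤U B U≤W
    with bx ← bits≤β (≤-trans (get≤ B x) (≤-trans (V≤2^*V (size (ifnz x c d)) U) U≤W))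
    with get s x in eq
  ... | zero
    with run D t≤ p≤ ← run-straight′ d ok′ 2≤U B
                         (≤-trans (pow-mono U (m≤n⇒m≤1+n (m≤n+m (size d) (size c)))) U≤W)
    = run (⇓ifnz-else eq D)
        (+-mono-≤ (subst (λ v → bits v ≤ β) (sym eq) bx)
          (≤-trans t≤ (*-monoˡ-≤ β (m≤n+m (size d) (size c))))) p≤
  ... | suc v
    with run D t≤ p≤ ← run-straight′ c ok 2≤U B
                         (≤-trans (pow-mono U (m≤n⇒m≤1+n (m≤m+n (size c) (size d)))) U≤W)
    = run (⇓ifnz-then (λ eq′ → contradiction (trans (sym eq) eq′) 1+n≢0) D)
        (+-mono-≤ (subst (λ v → bits v ≤ β) (sym eq) bx)
          (≤-trans t≤ (*-monoˡ-≤ β (m≤m+n (size c) (size d))))) p≤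

  run-straight : ∀ {s : State r} c {ok : Straight c} → size c ≤ ℓ → Bounded V s →
    Run c s (eval c s) (size c)
  run-straight c {ok} c≤ℓ B = run-straight′ c ok 2≤V B (pow-mono V c≤ℓ)

  run-seq : ∀ {c d} {s s′ s″ : State r} {N M} →
    Run c s s′ N → Run d s′ s″ M → Run (c ⨾ d) s s″ (N + M)
  run-seq {N = N} {M} (run D t≤ p≤) (run D′ t≤′ p≤′) =
    run (⇓seq D D′) (≤-trans (+-mono-≤ t≤ t≤′) (≤-reflexive (sym (*-distribʳ-+ β N M))))
        (⊔-lub p≤ p≤′)

  run-stop : ∀ {x c} {s : State r} → Bounded V s → get s x ≡ 0 → Run (whilenz x c) s s 1
  run-stop {x = x} B eq =
    run (⇓whilenz-stop eq) (≤-trans (bits≤β (≤-trans (get≤ B x) V≤W)) (m≤m+n β 0))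
        (space≤ (Bounded-mono V≤W B))

  run-step : ∀ {x c} {s s′ s″ : State r} {N M} → Bounded V s → get s x ≢ 0 →
    Run c s s′ N → Run (whilenz x c) s′ s″ M → Run (whilenz x c) s s″ (suc N + M)
  run-step {x = x} {N = N} {M} B neq (run D t≤ p≤) (run D′ t≤′ p≤′) =
    run (⇓whilenz-step neq D D′)
      (+-mono-≤ (bits≤β (≤-trans (get≤ B x) V≤W))
        (≤-trans (+-mono-≤ t≤ t≤′) (≤-reflexive (sym (*-distribʳ-+ β N M)))))
      (⊔-lub p≤ p≤′)

  run-mono : ∀ {c} {s s′ : State r} {N M} → N ≤ M → Run c s s′ N → Run c s s′ M
  run-mono N≤M (run D t≤ p≤) = run D (≤-trans t≤ (*-monoˡ-≤ β N≤M)) p≤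

-- Assignments as numbers

-- Little-endian: the first variable is the lowest bit.
idx : List Bool → ℕ
idx []      = 0
idx (b ∷ w) = bit b + (idx w + idx w)

index : Assignment n → ℕ
index z = idx (Vec.toList z)

shift : ℕ → ℕ → ℕ
shift zero    y = y
shift (suc v) y = shift v ⌊ y /2⌋

lowBit : ℕ → ℕ
lowBit y = y ∸ (⌊ y /2⌋ + ⌊ y /2⌋)

half-bit : ∀ b m → ⌊ bit b + (m + m) /2⌋ ≡ m
half-bit false m = sym (n≡⌊n+n/2⌋ m)
half-bit true  m = sym (n≡⌈n+n/2⌉ m)

lowBit-bit : ∀ b m → lowBit (bit b + (m + m)) ≡ bit b
lowBit-bit b m rewrite half-bit b m = m+n∸n≡m (bit b) (m + m)

lowBit-shift : (z : Assignment n) (i : Fin n) →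
  lowBit (shift (toℕ i) (index z)) ≡ bit (Vec.lookup z i)
lowBit-shift (b ∷ z) zero    = lowBit-bit b (index z)
lowBit-shift (b ∷ z) (suc i) rewrite half-bit b (index z) = lowBit-shift z i

idx< : ∀ w → idx w < 2 ^ length w
idx< []      = s≤s z≤n
idx< (b ∷ w) = begin-strict
  bit b + (idx w + idx w)              ≤⟨ +-monoˡ-≤ (idx w + idx w) (bit≤1 b) ⟩
  suc (idx w + idx w)                  <⟨ s≤s (≤-reflexive (sym (+-suc (idx w) (idx w)))) ⟩
  suc (idx w) + suc (idx w)            ≤⟨ +-mono-≤ (idx< w) (idx< w) ⟩
  2 ^ length w + 2 ^ length w          ≡⟨ cong (2 ^ length w +_) (+-identityʳ _) ⟨
  2 ^ length (b ∷ w)                   ∎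
  where
  open ≤-Reasoning
  bit≤1 : ∀ b → bit b ≤ 1
  bit≤1 false = z≤n
  bit≤1 true  = s≤s z≤n

lowBits : ℕ → ℕ → List ℕ
lowBits zero    y = []
lowBits (suc c) y = lowBit y ∷ lowBits c ⌊ y /2⌋

length-lowBits : ∀ c y → length (lowBits c y) ≡ c
length-lowBits zero    y = refl
length-lowBits (suc c) y = cong suc (length-lowBits c ⌊ y /2⌋)

regroup : ∀ b i p a → b + (i + i) + (p + (p + 0)) * a ≡ b + ((i + p * a) + (i + p * a))
regroup = solve-∀

-- This decodes the answer: the winning value is the index of an assignment plus a multiple of
-- `2 ^ n` that stores the distance, and reading `n` bits forgets the multiple.
lowBits-index : (z : Assignment n) (a : ℕ) →
  lowBits n (index z + 2 ^ n * a) ≡ encodeAssignment z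
lowBits-index         []      a = refl
lowBits-index {suc n} (b ∷ z) a
  rewrite regroup (bit b) (index z) (2 ^ n) a
  = cong₂ _∷_ (lowBit-bit b (index z + 2 ^ n * a))
      (trans (cong (lowBits n) (half-bit b (index z + 2 ^ n * a))) (lowBits-index z a))

-- Evaluation of a formula at a number

differ : ℕ → ℕ → ℕ
differ a b = (a ∸ b) + (b ∸ a)

-- The disjunction of `k` with the truth of the literal, without a branch: `differ` is 0 if the
-- literal holds and 1 otherwise, and subtracting `k = 1` turns it into 0 in either case.
literalVal : ℕ → ℕ → ℕ → ℕ
literalVal y s k = 1 ∸ (differ (lowBit y) s ∸ k)

clauseVal : ℕ → ℕ → Clause n → ℕ
clauseVal x k []      = k
clauseVal x k (ℓ ∷ C) =
  clauseVal x (literalVal (shift (toℕ (var ℓ)) x) (bit (sign ℓ)) k) C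

-- On truth values, `s ∸ (1 ∸ v)` is the conjunction of `s` and `v`.
cnfVal : ℕ → ℕ → CNF n → ℕ
cnfVal x s []      = s
cnfVal x s (C ∷ F) = cnfVal x (s ∸ (1 ∸ clauseVal x 0 C)) F

Reflects : Set → ℕ → Set
Reflects P v = (P × v ≡ 1) ⊎ ((¬ P) × v ≡ 0)

literalVal≤1 : ∀ y s k → literalVal y s k ≤ 1
literalVal≤1 y s k = m∸n≤m 1 (differ (lowBit y) s ∸ k)

lowBit≤1 : ∀ y → lowBit y ≤ 1
lowBit≤1 zero          = z≤n
lowBit≤1 (suc zero)    = s≤s z≤n
lowBit≤1 (suc (suc y)) rewrite +-suc ⌊ y /2⌋ ⌊ y /2⌋ = lowBit≤1 y

literalVal-1 : ∀ y b → literalVal y (bit b) 1 ≡ 1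
literalVal-1 y b = cong (1 ∸_) (m≤n⇒m∸n≡0 (differ≤1 b (lowBit≤1 y)))
  where
  differ≤1 : ∀ {a} b → a ≤ 1 → differ a (bit b) ≤ 1
  differ≤1 false z≤n       = z≤n
  differ≤1 false (s≤s z≤n) = s≤s z≤n
  differ≤1 true  z≤n       = s≤s z≤n
  differ≤1 true  (s≤s z≤n) = z≤n

clauseVal-1 : ∀ x (C : Clause n) → clauseVal x 1 C ≡ 1
clauseVal-1 x []      = refl
clauseVal-1 x (ℓ ∷ C)
  rewrite literalVal-1 (shift (toℕ (var ℓ)) x) (sign ℓ) = clauseVal-1 x C

extend-unsat : ∀ (z : Assignment n) ℓ C {v} → ¬ (z ⊨ˡ ℓ) →
  Reflects (z ⊨ᶜ C) v → Reflects (z ⊨ᶜ (ℓ ∷ C)) v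
extend-unsat z ℓ C ¬p (inj₁ (p , e)) = inj₁ (there p , e)
extend-unsat z ℓ C ¬p (inj₂ (q , e)) = inj₂ ((λ { (here p) → ¬p p ; (there p) → q p }) , e)

clauseVal-reflects : (z : Assignment n) (C : Clause n) →
  Reflects (z ⊨ᶜ C) (clauseVal (index z) 0 C)
clauseVal-reflects z []      = inj₂ ((λ ()) , refl)
clauseVal-reflects z (ℓ ∷ C)
  rewrite lowBit-shift z (var ℓ)
  with Vec.lookup z (var ℓ) in eq | sign ℓ in eq′
... | false | false = inj₁ (here (trans eq (sym eq′)) , clauseVal-1 (index z) C)
... | true  | true  = inj₁ (here (trans eq (sym eq′)) , clauseVal-1 (index z) C)
... | false | true  = extend-unsat z ℓ C (λ p → contradiction (trans (sym eq) (trans p eq′)) λ ())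
                                   (clauseVal-reflects z C)
... | true  | false = extend-unsat z ℓ C (λ p → contradiction (trans (sym eq) (trans p eq′)) λ ())
                                   (clauseVal-reflects z C)

cnfVal-0 : ∀ x (F : CNF n) → cnfVal x 0 F ≡ 0
cnfVal-0 x []      = refl
cnfVal-0 x (C ∷ F) rewrite 0∸n≡0 (1 ∸ clauseVal x 0 C) = cnfVal-0 x F

cnfVal-reflects : (z : Assignment n) (F : CNF n) → Reflects (z ⊨ F) (cnfVal (index z) 1 F)
cnfVal-reflects z []      = inj₁ ([] , refl)
cnfVal-reflects z (C ∷ F) with clauseVal-reflects z C
... | inj₂ (¬p , e) rewrite e = inj₂ ((λ { (p ∷ _) → ¬p p }) , cnfVal-0 (index z) F)
... | inj₁ (p , e)  rewrite e with cnfVal-reflects z F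
...   | inj₁ (q , e′)  = inj₁ (p ∷ q , e′)
...   | inj₂ (¬q , e′) = inj₂ ((λ { (_ ∷ q) → ¬q q }) , e′)

-- Words in counting order

extend : List (List Bool) → List (List Bool)
extend []       = []
extend (w ∷ ws) = (false ∷ w) ∷ (true ∷ w) ∷ extend ws

words : ℕ → List (List Bool)
words zero    = [] ∷ []
words (suc n) = extend (words n)

extend-++ : ∀ us ws → extend (us ++ ws) ≡ extend us ++ extend ws
extend-++ []       ws = refl
extend-++ (u ∷ us) ws = cong (λ vs → (false ∷ u) ∷ (true ∷ u) ∷ vs) (extend-++ us ws)

extend-∷ʳ : ∀ b ws → extend (map (_∷ʳ b) ws) ≡ map (_∷ʳ b) (extend ws)
extend-∷ʳ b []       = refl
extend-∷ʳ b (w ∷ ws) = cong (λ vs → (false ∷ w ∷ʳ b) ∷ (true ∷ w ∷ʳ b) ∷ vs) (extend-∷ʳ b ws)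

-- `words` grows at the lowest bit, but the program cuts a table into its two halves, that is, by
-- the highest bit. This second recursion for the same list connects the two.
words-∷ʳ : ∀ n → words (suc n) ≡ map (_∷ʳ false) (words n) ++ map (_∷ʳ true) (words n)
words-∷ʳ zero    = refl
words-∷ʳ (suc n) = begin
  extend (words (suc n))
    ≡⟨ cong extend (words-∷ʳ n) ⟩
  extend (map (_∷ʳ false) (words n) ++ map (_∷ʳ true) (words n))
    ≡⟨ extend-++ (map (_∷ʳ false) (words n)) _ ⟩
  extend (map (_∷ʳ false) (words n)) ++ extend (map (_∷ʳ true) (words n))
    ≡⟨ cong₂ _++_ (extend-∷ʳ false (words n)) (extend-∷ʳ true (words n)) ⟩
  map (_∷ʳ false) (words (suc n)) ++ map (_∷ʳ true) (words (suc n)) ∎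
  where open ≡-Reasoning

∈-extend : ∀ b {w ws} → w ∈ ws → (b ∷ w) ∈ extend ws
∈-extend false (here refl) = here refl
∈-extend true  (here refl) = there (here refl)
∈-extend b     (there p)   = there (there (∈-extend b p))

∈-words : (z : Assignment n) → Vec.toList z ∈ words n
∈-words []      = here refl
∈-words (b ∷ z) = ∈-extend b (∈-words z)

∈-extend⁻ : ∀ {w} ws → w ∈ extend ws → ∃[ b ] ∃[ u ] w ≡ b ∷ u × u ∈ ws
∈-extend⁻ (u ∷ ws) (here refl)         = false , u , refl , here refl
∈-extend⁻ (u ∷ ws) (there (here refl)) = true , u , refl , here refl
∈-extend⁻ (u ∷ ws) (there (there p)) with b , u′ , eq , q ← ∈-extend⁻ ws p =
  b , u′ , eq , there q

∈-words⁻ : ∀ {n w} → w ∈ words n → Σ[ z ∈ Assignment n ] w ≡ Vec.toList z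
∈-words⁻ {zero}  (here refl) = [] , refl
∈-words⁻ {suc n} p with b , u , eq , q ← ∈-extend⁻ (words n) p
                   with z , eq′ ← ∈-words⁻ q = b ∷ z , trans eq (cong (b ∷_) eq′)

count : ℕ → ℕ → List ℕ
count x zero    = []
count x (suc c) = x ∷ count (x + 1) c

double : List ℕ → List ℕ
double []       = []
double (x ∷ xs) = (x + x) ∷ suc (x + x) ∷ double xs

idx-extend : ∀ ws → map idx (extend ws) ≡ double (map idx ws)
idx-extend []       = refl
idx-extend (w ∷ ws) = cong (λ vs → (idx w + idx w) ∷ suc (idx w + idx w) ∷ vs) (idx-extend ws)

double-count : ∀ x c → double (count x c) ≡ count (x + x) (c + c)
double-count x zero    = refl
double-count x (suc c) rewrite +-suc c c =
  cong ((x + x) ∷_) (cong₂ _∷_ (sym (+-comm (x + x) 1))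
    (trans (double-count (x + 1) c) (cong (λ y → count y (c + c)) (lemma x))))
  where
  lemma : ∀ x → (x + 1) + (x + 1) ≡ x + x + 1 + 1
  lemma = solve-∀

-- Hence the position of a word in a table is its own number, and a loop that only increments a
-- counter visits the words in the order of `words`.
idx-words : ∀ n → map idx (words n) ≡ count 0 (2 ^ n)
idx-words zero    = refl
idx-words (suc n) = begin
  map idx (extend (words n))    ≡⟨ idx-extend (words n) ⟩
  double (map idx (words n))    ≡⟨ cong double (idx-words n) ⟩
  double (count 0 (2 ^ n))      ≡⟨ double-count 0 (2 ^ n) ⟩
  count 0 (2 ^ n + 2 ^ n)       ≡⟨ cong (λ m → count 0 (2 ^ n + m)) (+-identityʳ (2 ^ n)) ⟨
  count 0 (2 ^ suc n)           ∎
  where open ≡-Reasoning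

length-count : ∀ x c → length (count x c) ≡ c
length-count x zero    = refl
length-count x (suc c) = cong suc (length-count (x + 1) c)

length-words : ∀ n → length (words n) ≡ 2 ^ n
length-words n = begin
  length (words n)             ≡⟨ length-map idx (words n) ⟨
  length (map idx (words n))   ≡⟨ cong length (idx-words n) ⟩
  length (count 0 (2 ^ n))     ≡⟨ length-count 0 (2 ^ n) ⟩
  2 ^ n                        ∎
  where open ≡-Reasoning

distBit : Bool → Bool → ℕ
distBit false false = 0
distBit true  true  = 0
distBit false true  = 1
distBit true  false = 1

dist : List Bool → List Bool → ℕ
dist []      _       = 0
dist (_ ∷ _) []      = 0
dist (a ∷ u) (b ∷ w) = distBit a b + dist u w

-- Swapping the arguments absorbs the symmetry of the distance: `dist` takes the satisfying word
-- first, the statements about `Tₙ` put the row `x` first.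
dist-d_H : (x y : Assignment n) → dist (Vec.toList x) (Vec.toList y) ≡ d_H y x
dist-d_H []          []          = refl
dist-d_H (false ∷ x) (false ∷ y) = dist-d_H x y
dist-d_H (false ∷ x) (true ∷ y)  = cong suc (dist-d_H x y)
dist-d_H (true ∷ x)  (false ∷ y) = cong suc (dist-d_H x y)
dist-d_H (true ∷ x)  (true ∷ y)  = dist-d_H x y

-- The layers as transforms of tables

module Tables (N : ℕ) where

  entry : ℕ → ℕ → ℕ
  entry x zero    = 0
  entry x (suc _) = N + x

  -- Equals 0 for a = 0 and N + a for a ≥ N.
  bump : ℕ → ℕ
  bump a = a + (N ∸ (N ∸ a))

  -- The machine cannot compare, but a + (c ∸ a) is the maximum of a and c.
  infixl 6 _⊕_
  _⊕_ : ℕ → ℕ → ℕ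
  a ⊕ b = a + (bump b ∸ a)

  -- A butterfly of constant geometry, as in Pease's form of the fast Fourier transform: operands
  -- half a table apart, results adjacent. The interleaving is the perfect shuffle that turns the
  -- last variable into the first.
  mix : List ℕ → List ℕ → List ℕ
  mix []       _        = []
  mix (_ ∷ _)  []       = []
  mix (a ∷ as) (b ∷ bs) = (a ⊕ b) ∷ (b ⊕ a) ∷ mix as bs

  Table : Set
  Table = List Bool → ℕ

  -- Treats the last variable and moves it to the front, so that all layers
  -- run the same code and n of them restore the order of the variables.
  stepT : Table → Table
  stepT T []      = T []
  stepT T (b ∷ u) = T (u ∷ʳ b) ⊕ T (u ∷ʳ not b)

  iterT : ℕ → Table → Table
  iterT zero    T = T
  iterT (suc i) T = stepT (iterT i T)

  -- `iterT` adds a step on the outside, `iterLayer` on the inside; this reconciles the two orders.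
  iterT-stepT : ∀ i T → iterT i (stepT T) ≡ iterT (suc i) T
  iterT-stepT zero    T = refl
  iterT-stepT (suc i) T = cong stepT (iterT-stepT i T)

  mix-map : ∀ T ws → mix (map (λ u → T (u ∷ʳ false)) ws) (map (λ u → T (u ∷ʳ true)) ws)
    ≡ map (stepT T) (extend ws)
  mix-map T []       = refl
  mix-map T (w ∷ ws) = cong (λ vs → stepT T (false ∷ w) ∷ stepT T (true ∷ w) ∷ vs) (mix-map T ws)

  layer : ℕ → List ℕ → List ℕ
  layer H t = mix (take H t) (drop H t)

  iterLayer : ℕ → ℕ → List ℕ → List ℕ
  iterLayer H zero    t = t
  iterLayer H (suc i) t = iterLayer H i (layer H t)

  take-drop-++ : ∀ {H} (as bs : List ℕ) → length as ≡ H →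
    take H (as ++ bs) ≡ as × drop H (as ++ bs) ≡ bs
  take-drop-++ []       bs refl = refl , refl
  take-drop-++ (a ∷ as) bs refl with p , q ← take-drop-++ as bs refl = cong (a ∷_) p , q

  -- By `words-∷ʳ` the two halves of the table hold the words ending in `false` and in `true`, in
  -- the same order, so `mix` meets exactly the pairs that `stepT` combines.
  layer-words : ∀ T n → layer (2 ^ n) (map T (words (suc n))) ≡ map (stepT T) (words (suc n))
  layer-words T n =
    trans (cong (layer (2 ^ n)) split)
      (trans (cong₂ mix (proj₁ td) (proj₂ td)) (mix-map T (words n)))
    where
    open ≡-Reasoning
    as = map (λ u → T (u ∷ʳ false)) (words n)
    bs = map (λ u → T (u ∷ʳ true)) (words n)
    td = take-drop-++ as bs (trans (length-map _ (words n)) (length-words n))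
    split : map T (words (suc n)) ≡ as ++ bs
    split = begin
      map T (words (suc n))    ≡⟨ cong (map T) (words-∷ʳ n) ⟩
      map T (map (_∷ʳ false) (words n) ++ map (_∷ʳ true) (words n)) ≡⟨ map-++ T (map (_∷ʳ false) (words n)) _ ⟩
      _                        ≡⟨ cong₂ _++_ (map-∘ (words n)) (map-∘ (words n)) ⟨
      as ++ bs ∎

  iterLayer-words : ∀ i T n → iterLayer (2 ^ n) i (map T (words (suc n))) ≡ map (iterT i T) (words (suc n))
  iterLayer-words zero    T n = refl
  iterLayer-words (suc i) T n = begin
    iterLayer (2 ^ n) i (layer (2 ^ n) (map T (words (suc n))))
      ≡⟨ cong (iterLayer (2 ^ n) i) (layer-words T n) ⟩
    iterLayer (2 ^ n) i (map (stepT T) (words (suc n)))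
      ≡⟨ iterLayer-words i (stepT T) n ⟩
    map (iterT i (stepT T)) (words (suc n))
      ≡⟨ cong (λ S → map S (words (suc n))) (iterT-stepT i T) ⟩
    map (iterT (suc i) T) (words (suc n)) ∎
    where open ≡-Reasoning

  ⊕-upperˡ : ∀ a b → a ≤ a ⊕ b
  ⊕-upperˡ a b = m≤m+n a _

  ⊕-upperʳ : ∀ a b → bump b ≤ a ⊕ b
  ⊕-upperʳ a b = m≤n+m∸n (bump b) a

  ⊕-sel : ∀ a b → a ⊕ b ≡ a ⊎ a ⊕ b ≡ bump b
  ⊕-sel a b with ≤-total a (bump b)
  ... | inj₁ a≤ = inj₂ (m+[n∸m]≡n a≤)
  ... | inj₂ ≤a = inj₁ (trans (cong (a +_) (m≤n⇒m∸n≡0 ≤a)) (+-identityʳ a))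

  bump≥ : ∀ {a} → N ≤ a → bump a ≡ a + N
  bump≥ {a} N≤a = cong (λ v → a + (N ∸ v)) (m≤n⇒m∸n≡0 N≤a)

  bump-0 : bump 0 ≡ 0
  bump-0 = n∸n≡0 N

  bump-≤ : ∀ {a c} → a ≤ c → bump a ≤ c + N
  bump-≤ {a} a≤c = +-mono-≤ a≤c (m∸n≤m N (N ∸ a))

  ⊕-≤ : ∀ {a b c} → a ≤ c → b ≤ c → a ⊕ b ≤ c + N
  ⊕-≤ {a} {b} {c} a≤c b≤c with ⊕-sel a b
  ... | inj₁ e rewrite e = ≤-trans a≤c (m≤m+n c N)
  ... | inj₂ e rewrite e = bump-≤ b≤c

  mix-≤ : ∀ {c as bs} → All (_≤ c) as → All (_≤ c) bs → All (_≤ c + N) (mix as bs)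
  mix-≤ []       _        = []
  mix-≤ (a ∷ as) []       = []
  mix-≤ (a ∷ as) (b ∷ bs) = ⊕-≤ a b ∷ ⊕-≤ b a ∷ mix-≤ as bs

  -- After i steps, the entry at v ++ u with v of length i is the maximum
  -- over the words p of length i of T (u ++ p), raised by N for each
  -- position where p and v differ.
  module _ (T : Table) (large : ∀ w → T w ≡ 0 ⊎ N ≤ T w) where

    record Value (u v p : List Bool) (t : ℕ) : Set where
      constructor value
      field
        length-≡ : length p ≡ length v
        rest     : T (u ++ p) ≢ 0 × t ≡ T (u ++ p) + dist p v * N

    Upper : List Bool → List Bool → ℕ → Set
    Upper u v t = ∀ {p a} → Value u v p a → a ≤ t

    -- The case `t ≡ 0` is the empty maximum. In the other case `N ≤ t` makes the next `bump` add
    -- exactly `N`.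
    Attained : List Bool → List Bool → ℕ → Set
    Attained u v t = t ≡ 0 ⊎ (N ≤ t × ∃[ p ] Value u v p t)

    shuffle : ∀ u (b : Bool) p → (u ∷ʳ b) ++ p ≡ u ++ b ∷ p
    shuffle u b p = ++-assoc u (b ∷ []) p

    realign : ∀ u (b : Bool) p {t d} → T ((u ∷ʳ b) ++ p) ≢ 0 × t ≡ T ((u ∷ʳ b) ++ p) + d →
      T (u ++ b ∷ p) ≢ 0 × t ≡ T (u ++ b ∷ p) + d
    realign u b p {t} {d} = subst (λ w → T w ≢ 0 × t ≡ T w + d) (shuffle u b p)

    Value-same : ∀ {u v p t} b → Value (u ∷ʳ b) v p t → Value u (b ∷ v) (b ∷ p) t
    Value-same {u} {v} {p} {t} b (value l V)
      with ≢0 , eq ← realign u b p V =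
      value (cong suc l) (≢0 , trans eq (cong (λ d → T (u ++ b ∷ p) + d * N) (lemma b)))
      where
      lemma : ∀ b → dist p v ≡ distBit b b + dist p v
      lemma false = refl
      lemma true  = refl

    Value-flip : ∀ {u v p t} b → N ≤ t → Value (u ∷ʳ not b) v p t → Value u (b ∷ v) (not b ∷ p) (bump t)
    Value-flip {u} {v} {p} {t} b N≤t (value l V)
      with ≢0 , eq ← realign u (not b) p V =
      value (cong suc l) (≢0 , trans (bump≥ N≤t) (trans (cong (_+ N) eq) (lemma b)))
      where
      lemma : ∀ b → T (u ++ not b ∷ p) + dist p v * N + N ≡
                    T (u ++ not b ∷ p) + (distBit (not b) b + dist p v) * N
      lemma false = trans (+-assoc (T _) _ N) (cong (T (u ++ true ∷ p) +_) (+-comm (dist p v * N) N))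
      lemma true  = trans (+-assoc (T _) _ N) (cong (T (u ++ false ∷ p) +_) (+-comm (dist p v * N) N))

    Value-large : ∀ {u v p t} → Value u v p t → N ≤ t
    Value-large {u} {v} {p} (value l (≢0 , refl)) with large (u ++ p)
    ... | inj₁ ≡0 = contradiction ≡0 ≢0
    ... | inj₂ N≤ = ≤-trans N≤ (m≤m+n _ _)

    -- A competitor `c ∷ p` either agrees with `b ∷ v` in the first letter, and the left operand
    -- already dominates it, or it differs there, and the `N` added by `bump` to the right operand
    -- pays for the difference.
    upper-step : ∀ u v b {s t} → Upper (u ∷ʳ b) v s → Upper (u ∷ʳ not b) v t → Upper u (b ∷ v) (s ⊕ t)
    upper-step u v b {s} {t} U U′ {c ∷ p} {a} (value l (≢0 , refl)) = by b c ≢0 U U′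
      where
      same : ∀ b → Upper (u ∷ʳ b) v s → T (u ++ b ∷ p) ≢ 0 → T (u ++ b ∷ p) + dist p v * N ≤ s ⊕ t
      same b U ≢0 = ≤-trans
        (subst (λ w → T w + dist p v * N ≤ s) (shuffle u b p)
          (U (value (suc-injective l) ((λ e → ≢0 (trans (cong T (sym (shuffle u b p))) e)) , refl))))
        (⊕-upperˡ s t)
      flip : ∀ c → Upper (u ∷ʳ c) v t → T (u ++ c ∷ p) ≢ 0 →
        T (u ++ c ∷ p) + (1 + dist p v) * N ≤ s ⊕ t
      flip c U ≢0 = begin
        T (u ++ c ∷ p) + (N + dist p v * N)    ≡⟨ cong (T (u ++ c ∷ p) +_) (+-comm N (dist p v * N)) ⟩
        T (u ++ c ∷ p) + (dist p v * N + N)    ≡⟨ +-assoc (T (u ++ c ∷ p)) (dist p v * N) N ⟨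
        T (u ++ c ∷ p) + dist p v * N + N      ≤⟨ +-monoˡ-≤ N (subst (λ w → T w + dist p v * N ≤ t) (shuffle u c p) (U V)) ⟩
        t + N                                  ≡⟨ bump≥ (≤-trans (Value-large V) (U V)) ⟨
        bump t                                 ≤⟨ ⊕-upperʳ s t ⟩
        s ⊕ t                                  ∎
        where
        open ≤-Reasoning
        V : Value (u ∷ʳ c) v p (T ((u ∷ʳ c) ++ p) + dist p v * N)
        V = value (suc-injective l) ((λ e → ≢0 (trans (cong T (sym (shuffle u c p))) e)) , refl)
      by : ∀ b c → T (u ++ c ∷ p) ≢ 0 → Upper (u ∷ʳ b) v s → Upper (u ∷ʳ not b) v t →
        T (u ++ c ∷ p) + (distBit c b + dist p v) * N ≤ s ⊕ t
      by false false ≢0 U U′ = same false U ≢0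
      by true  true  ≢0 U U′ = same true U ≢0
      by true  false ≢0 U U′ = flip false U′ ≢0
      by false true  ≢0 U U′ = flip true U′ ≢0

    attained-step : ∀ u v b {s t} → Attained (u ∷ʳ b) v s → Attained (u ∷ʳ not b) v t → Attained u (b ∷ v) (s ⊕ t)
    attained-step u v b {s} {t} A A′ with ⊕-sel s t
    ... | inj₁ e rewrite e = keep A
      where
      keep : Attained (u ∷ʳ b) v s → Attained u (b ∷ v) s
      keep (inj₁ ≡0)           = inj₁ ≡0
      keep (inj₂ (N≤s , p , V)) = inj₂ (N≤s , b ∷ p , Value-same b V)
    ... | inj₂ e rewrite e = keep A′
      where
      keep : Attained (u ∷ʳ not b) v t → Attained u (b ∷ v) (bump t)
      keep (inj₁ refl)         = inj₁ bump-0
      keep (inj₂ (N≤t , p , V)) = inj₂ (≤-trans N≤t (m≤m+n t _) , not b ∷ p , Value-flip b N≤t V)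

    -- Induction on `v` with `u` general: one `stepT` at `(b ∷ v) ++ u` reads the previous layer at
    -- `v ++ (u ∷ʳ b)` and `v ++ (u ∷ʳ not b)`, so letters leave `v` at its front and gather at the
    -- end of `u`.
    iterT-max : ∀ u v → Upper u v (iterT (length v) T (v ++ u)) × Attained u v (iterT (length v) T (v ++ u))
    iterT-max u [] = upper , attained
      where
      upper : Upper u [] (T u)
      upper {[]} (value _ (_ , refl)) rewrite ++-identityʳ u | +-identityʳ (T u) = ≤-refl
      attained : Attained u [] (T u)
      attained with large u
      ... | inj₁ ≡0 = inj₁ ≡0
      ... | inj₂ N≤ with T u in eq
      -- `N` is arbitrary here and may be 0, so `N ≤ T u` does not yet exclude this case.
      ...   | zero  = inj₁ refl
      ...   | suc t = inj₂ (N≤ , [] , value refl ((λ e → 1+n≢0 (trans (sym eq′) e)) ,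
                                                 sym (trans (+-identityʳ _) eq′)))
        where
        eq′ : T (u ++ []) ≡ suc t
        eq′ = trans (cong T (++-identityʳ u)) eq
    iterT-max u (b ∷ v)
      rewrite ++-assoc v u (b ∷ []) | ++-assoc v u (not b ∷ [])
      with U , A ← iterT-max (u ∷ʳ b) v | U′ , A′ ← iterT-max (u ∷ʳ not b) v =
      upper-step u v b U U′ , attained-step u v b A A′

-- The scan for the best satisfying assignment

-- The first argument is the entry of the first table. It tells whether `x` satisfies the formula,
-- which the last table cannot: once the formula is satisfiable, that table is nonzero everywhere.
scanStep : ℕ → ℕ → ℕ → ℕ × ℕ → ℕ × ℕ
scanStep zero    b x (s , k) = s , k
scanStep (suc _) b x (s , k) with b ∸ s
... | zero  = s , k
... | suc _ = b , x

scan : ℕ → List ℕ → List ℕ → ℕ × ℕ → ℕ × ℕ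
scan x []       _        r = r
scan x (_ ∷ _)  []       r = r
scan x (a ∷ as) (b ∷ bs) r = scan (x + 1) as bs (scanStep a b x r)

module _ (S T : List Bool → ℕ) where

  Witness : List (List Bool) → ℕ × ℕ → Set
  Witness ws (s , k) = ∃[ w ] w ∈ ws × S w ≢ 0 × s ≡ T w × k ≡ idx w

  scanStep-spec : ∀ w r → let r′ = scanStep (S w) (T w) (idx w) r in
    proj₁ r ≤ proj₁ r′ × (S w ≢ 0 → T w ≤ proj₁ r′) × (r′ ≡ r ⊎ (S w ≢ 0 × r′ ≡ (T w , idx w)))
  scanStep-spec w (s , k) with S w
  ... | zero  = ≤-refl , (λ ≢0 → contradiction refl ≢0) , inj₁ refl
  ... | suc a with T w ∸ s in eq
  ...   | zero  = ≤-refl , (λ _ → m∸n≡0⇒m≤n eq) , inj₁ refl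
  ...   | suc d = <⇒≤ (m∸n≢0⇒n<m (λ e → 1+n≢0 (trans (sym eq) e))) , (λ _ → ≤-refl) , inj₂ ((λ ()) , refl)

  -- The hypothesis keeps the counter `x` of the machine in step with the words, so that the
  -- recorded position is the number of the winning word.
  scan-spec : ∀ x c ws r → map idx ws ≡ count x c →
    let r′ = scan x (map S ws) (map T ws) r in
    proj₁ r ≤ proj₁ r′ × (∀ {w} → w ∈ ws → S w ≢ 0 → T w ≤ proj₁ r′) × (r′ ≡ r ⊎ Witness ws r′)
  scan-spec x c       []       r eq = ≤-refl , (λ ()) , inj₁ refl
  scan-spec x (suc c) (w ∷ ws) r eq
    with refl , eq′ ← ∷-injective eq
    with r≤ , w≤ , from ← scanStep-spec w r
    with r≤′ , ws≤ , from′ ← scan-spec (idx w + 1) c ws (scanStep (S w) (T w) (idx w) r) eq′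
    = ≤-trans r≤ r≤′ ,
      (λ { (here refl) ≢0 → ≤-trans (w≤ ≢0) r≤′ ; (there p) ≢0 → ws≤ p ≢0 }) ,
      origin from from′
    where
    origin : ∀ {r′ r″} → r′ ≡ r ⊎ (S w ≢ 0 × r′ ≡ (T w , idx w)) → r″ ≡ r′ ⊎ Witness ws r″ →
      r″ ≡ r ⊎ Witness (w ∷ ws) r″
    origin _                  (inj₂ (v , p , q)) = inj₂ (v , there p , q)
    origin (inj₁ refl)        (inj₁ refl)        = inj₁ refl
    origin (inj₂ (≢0 , refl)) (inj₁ refl)        = inj₂ (w , here refl , ≢0 , refl , refl)

-- Memory segments

-- Stronger than `read m i ≡ a`, since cells beyond the memory also read as 0: the cell must exist.
-- This makes the relation stable when the memory is extended at its end.
data At : List ℕ → ℕ → ℕ → Set where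
  here  : ∀ {a m} → At (a ∷ m) 0 a
  there : ∀ {a b i m} → At m i a → At (b ∷ m) (suc i) a

Seg : List ℕ → ℕ → List ℕ → Set
Seg m p []       = ⊤
Seg m p (a ∷ as) = At m p a × Seg m (p + 1) as

-- The sum `p + c` in the form in which a pointer reaches it, by `c` increments. With `Seg` and
-- `count` written in the same way, the pointers after a loop agree by computation.
up : ℕ → ℕ → ℕ
up p zero    = p
up p (suc c) = up (p + 1) c

up-+ : ∀ p c → up p c ≡ p + c
up-+ p zero    = sym (+-identityʳ p)
up-+ p (suc c) = trans (up-+ (p + 1) c) (+-assoc p 1 c)

read-At : ∀ {m i a} → At m i a → read m i ≡ a
read-At here      = refl
read-At (there q) = read-At q

All-At : ∀ {P : ℕ → Set} {m i a} → At m i a → All P m → P a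
All-At here      (p ∷ _)  = p
All-At (there q) (_ ∷ ps) = All-At q ps

At-++ : ∀ {m i a} r → At m i a → At (m ++ r) i a
At-++ r here      = here
At-++ r (there q) = there (At-++ r q)

At-length : ∀ P {a r} → At (P ++ a ∷ r) (length P) a
At-length []      = here
At-length (_ ∷ P) = there (At-length P)

Seg-++ : ∀ {m p} as r → Seg m p as → Seg (m ++ r) p as
Seg-++ []       r _       = tt
Seg-++ (a ∷ as) r (q , s) = At-++ r q , Seg-++ as r s

Seg-length : ∀ P as r → Seg (P ++ as ++ r) (length P) as
Seg-length P []       r = tt
Seg-length P (a ∷ as) r = At-length P ,
  subst₂ (λ m p → Seg m p as) (++-assoc P (a ∷ []) (as ++ r)) (length-++ P) (Seg-length (P ∷ʳ a) as r)

Seg-drop : ∀ {m p} as {bs} → Seg m p (as ++ bs) → Seg m (up p (length as)) bs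
Seg-drop []       s       = s
Seg-drop (a ∷ as) (_ , s) = Seg-drop as s

All-Seg : ∀ {P : ℕ → Set} {m p} as → Seg m p as → All P m → All P as
All-Seg []       _       ps = []
All-Seg (a ∷ as) (q , s) ps = All-At q ps ∷ All-Seg as s ps

write-length : ∀ m w → write m (length m) w ≡ m ∷ʳ w
write-length []      w = refl
write-length (_ ∷ m) w = cong (_ ∷_) (write-length m w)

write₂-length : ∀ m v w → write (write m (length m) v) (length m + 1) w ≡ m ++ v ∷ w ∷ []
write₂-length []      v w = refl
write₂-length (_ ∷ m) v w = cong (_ ∷_) (write₂-length m v w)

writes : ℕ → List ℕ → List ℕ → List ℕ
writes p []       m = m
writes p (w ∷ ws) m = writes (p + 1) ws (write m p w)

-- The layout of the tables in memory

module Layout (N H : ℕ) where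

  open Tables N

  table : ∀ {n} → CNF n → ℕ → ℕ
  table F x = entry x (cnfVal x 1 F)

  -- The two summands `H` have different sources: the loop over `mixBody` advances the pointer
  -- through the first half of a table, and `layerEnd` skips the second.
  lastTable : ℕ → ℕ → ℕ
  lastTable p zero    = p
  lastTable p (suc c) = lastTable (up p H + H) c

  grow : ℕ → List ℕ → List ℕ
  grow zero    t = []
  grow (suc c) t = layer H t ++ grow c (layer H t)

  length-mix : ∀ {h} as bs → length as ≡ h → length bs ≡ h → length (mix as bs) ≡ h + h
  length-mix []       []       refl _   = refl
  length-mix (a ∷ as) (b ∷ bs) refl lbs =
    trans (cong 2+ (length-mix as bs refl (suc-injective lbs)))
      (cong suc (sym (+-suc (length as) (length as))))

  length-take-H : ∀ (t : List ℕ) → length t ≡ H + H → length (take H t) ≡ H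
  length-take-H t eq rewrite length-take H t | eq = m≤n⇒m⊓n≡m (m≤m+n H H)

  length-drop-H : ∀ (t : List ℕ) → length t ≡ H + H → length (drop H t) ≡ H
  length-drop-H t eq rewrite length-drop H t | eq = m+n∸n≡m H H

  length-layer : ∀ t → length t ≡ H + H → length (layer H t) ≡ H + H
  length-layer t eq = length-mix (take H t) (drop H t) (length-take-H t eq) (length-drop-H t eq)

  lastTable-length : ∀ t (Q : List ℕ) → length t ≡ H + H → up (length Q) H + H ≡ length (Q ++ t)
  lastTable-length t Q lt = begin
    up (length Q) H + H      ≡⟨ cong (_+ H) (up-+ (length Q) H) ⟩
    length Q + H + H         ≡⟨ +-assoc (length Q) H H ⟩
    length Q + (H + H)       ≡⟨ cong (length Q +_) lt ⟨
    length Q + length t      ≡⟨ length-++ Q ⟨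
    length (Q ++ t)          ∎
    where open ≡-Reasoning

  -- The alternative `c ≡ 0` covers formulas without variables: their table has a single entry and
  -- cannot be halved, but no layer is run on it.
  Seg-lastTable : ∀ c t Q → c ≡ 0 ⊎ length t ≡ H + H →
    Seg ((Q ++ t) ++ grow c t) (lastTable (length Q) c) (iterLayer H c t)
  Seg-lastTable zero t Q _ =
    subst (λ m → Seg m (length Q) t) (sym (++-assoc Q t [])) (Seg-length Q t [])
  Seg-lastTable (suc c) t Q (inj₂ lt) =
    subst₂ (λ m p → Seg m (lastTable p c) (iterLayer H c (layer H t)))
      (++-assoc (Q ++ t) (layer H t) _) (sym (lastTable-length t Q lt))
      (Seg-lastTable c (layer H t) (Q ++ t) (inj₂ (length-layer t lt)))

  length-grow : ∀ c t → c ≡ 0 ⊎ length t ≡ H + H → length (grow c t) ≡ c * (H + H)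
  length-grow zero    t _         = refl
  length-grow (suc c) t (inj₂ lt) = trans (length-++ (layer H t))
    (cong₂ _+_ (length-layer t lt) (length-grow c (layer H t) (inj₂ (length-layer t lt))))

  lastTable-≡ : ∀ p c → lastTable p c ≡ p + c * (H + H)
  lastTable-≡ p zero    = sym (+-identityʳ p)
  lastTable-≡ p (suc c) = begin
    lastTable (up p H + H) c         ≡⟨ lastTable-≡ (up p H + H) c ⟩
    up p H + H + c * (H + H)         ≡⟨ cong (λ q → q + H + c * (H + H)) (up-+ p H) ⟩
    p + H + H + c * (H + H)          ≡⟨ cong (_+ c * (H + H)) (+-assoc p H H) ⟩
    p + (H + H) + c * (H + H)        ≡⟨ +-assoc p (H + H) (c * (H + H)) ⟩
    p + suc c * (H + H)              ∎
    where open ≡-Reasoning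

  grow-≤ : ∀ {b} c t → All (_≤ b) t → All (_≤ b + c * N) (grow c t)
  grow-≤ zero    t t≤ = []
  grow-≤ {b} (suc c) t t≤ = ++⁺
    (All.map (λ v → ≤-trans v (+-monoʳ-≤ b (m≤m+n N (c * N)))) layer≤)
    (All.map (λ v → ≤-trans v (≤-reflexive (+-assoc b N (c * N)))) (grow-≤ c (layer H t) layer≤))
    where
    layer≤ : All (_≤ b + N) (layer H t)
    layer≤ = mix-≤ (take⁺ H t≤) (drop⁺ H t≤)

-- The program

-- r1 holds 1, rN 2ⁿ, rH ⌊2ⁿ/2⌋, rf the end of the input, re that of the memory,
-- where all tables are appended; ra and rb are 0 between loop-free commands.
r1 rn rN rH rf re rc rx rp rg rl rs rk rv ry ra rb : Reg 17
r1 = # 0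
rn = # 1
rN = # 2
rH = # 3
rf = # 4
re = # 5
rc = # 6
rx = # 7
rp = # 8
rg = # 9
rl = # 10
rs = # 11
rk = # 12
rv = # 13
ry = # 14
ra = # 15
rb = # 16

block : ∀ {r} → List (Instr r) → Cmd r
block []       = skip
block (i ∷ is) = instr i ⨾ block is

-- As `ra` is 0 at the start of a block, `add x ra y` serves as a move and `load rf ra` fetches the
-- length prefix at address 0. Clearing registers after use keeps the loop invariants free of
-- leftover values.
initialize powerBody powerEnd shiftBody literalStart literalEnd clauseStart clauseEnd : Cmd 17
initialize = block
  ( const r1 1 ∷ load rn r1 ∷ load rf ra ∷ add rf rf r1 ∷ add re ra rf
  ∷ const rN 1 ∷ add rc ra rn ∷ [])
powerBody = block (add rN rN rN ∷ sub rc rc r1 ∷ [])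
powerEnd = block (half rH rN ∷ add rc ra rN ∷ [])
shiftBody = block (half ry ry ∷ sub rv rv r1 ∷ [])
literalStart = block (load rv rp ∷ add rp rp r1 ∷ add ry ra rx ∷ [])
literalEnd = block
  ( half rb ry ∷ add rb rb rb ∷ sub ra ry rb ∷ load rb rp ∷ add rp rp r1
  ∷ sub rv ra rb ∷ sub rb rb ra ∷ add rv rv rb ∷ sub rv rv rk ∷ sub rk r1 rv
  ∷ const rv 0 ∷ const ry 0 ∷ const ra 0 ∷ const rb 0 ∷ sub rl rl r1 ∷ [])
clauseStart = block (load rl rp ∷ add rp rp r1 ∷ [])
clauseEnd = block
  (sub ra r1 rk ∷ sub rs rs ra ∷ const rk 0 ∷ const ra 0 ∷ sub rg rf rp ∷ [])

literalBody clauseBody : Cmd 17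
literalBody = literalStart ⨾ whilenz rv shiftBody ⨾ literalEnd
clauseBody = clauseStart ⨾ whilenz rl literalBody ⨾ clauseEnd

rowStart rowEnd rowBody : Cmd 17
-- The clauses begin at address 2, after the length prefix and `n`. The difference `rf ∸ rp` counts
-- the unread cells of the input and controls the loop.
rowStart = block (const rp 2 ∷ const rs 1 ∷ sub rg rf rp ∷ [])
rowEnd = ifnz rs (instr (add ra rN rx)) skip ⨾ block
  ( store re ra ∷ add re re r1 ∷ add rx rx r1 ∷ sub rc rc r1
  ∷ const ra 0 ∷ const rs 0 ∷ const rp 0 ∷ [])
rowBody = rowStart ⨾ whilenz rg clauseBody ⨾ rowEnd

layersStart mixBody layerStart layerEnd layerBody : Cmd 17
layersStart = block (const rx 0 ∷ add rp ra rf ∷ add rc ra rn ∷ [])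
mixBody = block
  ( load ra rp ∷ add rb rp rH ∷ load rb rb
  ∷ sub rv rN rb ∷ sub rv rN rv ∷ add rv rb rv ∷ sub rv rv ra ∷ add rv ra rv
  ∷ store re rv ∷ add re re r1
  ∷ sub rv rN ra ∷ sub rv rN rv ∷ add rv ra rv ∷ sub rv rv rb ∷ add rv rb rv
  ∷ store re rv ∷ add re re r1
  ∷ add rp rp r1 ∷ sub rl rl r1 ∷ const ra 0 ∷ const rb 0 ∷ const rv 0 ∷ [])
layerStart = block (add rl ra rH ∷ [])
layerEnd = block (add rp rp rH ∷ sub rc rc r1 ∷ [])
layerBody = layerStart ⨾ whilenz rl mixBody ⨾ layerEnd

scanStart scanBody : Cmd 17
scanStart = block (add rg ra rf ∷ add rc ra rN ∷ [])
scanBody = block (load ra rg ∷ load rb rp ∷ [])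
  ⨾ ifnz ra (instr (sub rv rb rs)
              -- Here `ra` is nonzero, so `rv`, cleared first, takes its place as the zero of the
              -- two moves.
              ⨾ ifnz rv (block (const rv 0 ∷ add rs rv rb ∷ add rk rv rx ∷ [])) skip)
            skip
  ⨾ block ( add rp rp r1 ∷ add rg rg r1 ∷ add rx rx r1 ∷ sub rc rc r1
          ∷ const ra 0 ∷ const rb 0 ∷ const rv 0 ∷ [])

outputStart outputNext outputBody : Cmd 17
outputStart = block
  -- The output overwrites the memory from address 0, with the length `n + n` as prefix. The input
  -- is no longer read, and both results are in registers.
  ( const rp 0 ∷ add rv rn rn ∷ store rp rv ∷ const rp 1 ∷ const rv 0
  ∷ add ry ra rk ∷ add rc ra rn ∷ [])
outputNext = block (add ry ra rs ∷ add rc ra rn ∷ [])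
outputBody = block
  ( half rb ry ∷ add ra rb rb ∷ sub ra ry ra ∷ store rp ra ∷ add rp rp r1
  ∷ const ra 0 ∷ add ry ra rb ∷ const rb 0 ∷ sub rc rc r1 ∷ [])

diameterProgram : Program
diameterProgram = program 17
  ( initialize ⨾ whilenz rc powerBody
  ⨾ powerEnd ⨾ whilenz rc rowBody
  ⨾ layersStart ⨾ whilenz rc layerBody
  ⨾ scanStart ⨾ whilenz rc scanBody
  ⨾ outputStart ⨾ whilenz rc outputBody
  ⨾ outputNext ⨾ whilenz rc outputBody)

state : (n N H f e c x p g l s k v y : ℕ) → List ℕ → State 17
state n N H f e c x p g l s k v y m =
  ⟪ 1 ∷ n ∷ N ∷ H ∷ f ∷ e ∷ c ∷ x ∷ p ∷ g ∷ l ∷ s ∷ k ∷ v ∷ y ∷ 0 ∷ 0 ∷ [] , m ⟫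

literalCost : ℕ → ℕ
literalCost n = size literalStart + (loopSteps 3 n + size literalEnd)

clauseCost : ℕ → ℕ → ℕ
clauseCost n w = size clauseStart + (loopSteps (literalCost n) w + size clauseEnd)

rowCost : ℕ → ℕ → ℕ → ℕ
rowCost n w q = size rowStart + (loopSteps (clauseCost n w) q + size rowEnd)

layerCost : ℕ → ℕ
layerCost H = size layerStart + (loopSteps (size mixBody) H + size layerEnd)

-- `N` and `H` are kept as parameters because the same expression at `N = H = 1` later gives the
-- polynomial factor in front of 2ⁿ.
steps : (n N H w q : ℕ) → ℕ
steps n N H w q =
    size initialize + (loopSteps (size powerBody) n
  + (size powerEnd + (loopSteps (rowCost n w q) N
  + (size layersStart + (loopSteps (layerCost H) n
  + (size scanStart + (loopSteps (size scanBody) N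
  + (size outputStart + (loopSteps (size outputBody) n
  + (size outputNext + loopSteps (size outputBody) n))))))))))

shift≤ : ∀ v y → shift v y ≤ y
shift≤ zero    y = ≤-refl
shift≤ (suc v) y = ≤-trans (shift≤ v ⌊ y /2⌋) (⌊n/2⌋≤n y)

-- Runs of the loops on bounded states

module Runs (ℓ V : ℕ) (32≤ℓ : 32 ≤ ℓ) (2≤V : 2 ≤ V) where

  open Exec ℓ V 2≤V

  upd : ∀ {r} {s : State r} x {w} → w ≤ V → Bounded V s → Bounded V (set s x w)
  upd x w≤V (bounded p q l) = bounded (update≤ x w≤V p) q l

  updMem : ∀ {r} {s : State r} {m} → All (_≤ V) m → length m ≤ V →
    Bounded V s → Bounded V ⟪ regs s , m ⟫
  updMem q l (bounded p _ _) = bounded p q l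

  1≤V : 1 ≤ V
  1≤V = ≤-trans (s≤s z≤n) 2≤V

  -- For a concrete block both side conditions compute to unit types or products of them, which Agda
  -- fills in; a block is executed by naming it.
  straight : ∀ {r} {s : State r} c {ok : Straight c} {_ : T (size c ≤ᵇ 32)} →
    Bounded V s → Run c s (eval c s) (size c)
  straight c {ok} {small} = run-straight c {ok} (≤-trans (≤ᵇ⇒≤ (size c) 32 small) 32≤ℓ)

  module _ {n N H f : ℕ} where

    st = state n N H f

    run-shift : ∀ {e c x p g l s k m} v y → Bounded V (st e c x p g l s k v y m) →
      Run (whilenz rv shiftBody) (st e c x p g l s k v y m)
        (st e c x p g l s k 0 (shift v y) m) (loopSteps 3 v)
    run-shift zero    y B = run-stop B refl
    run-shift (suc v) y B = run-step B (λ ()) (straight shiftBody B)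
      (run-shift v ⌊ y /2⌋
        (upd rv (≤-trans (n≤1+n v) (get≤ B rv)) (upd ry (≤-trans (⌊n/2⌋≤n y) (get≤ B ry)) B)))

    run-literal : ∀ {e c x p g l s k m} v b → v ≤ n → At m p v → At m (p + 1) b → p + 1 ≤ V →
      Bounded V (st e c x p g (suc l) s k 0 0 m) →
      Run literalBody (st e c x p g (suc l) s k 0 0 m)
        (st e c x (p + 1 + 1) g l s (literalVal (shift v x) b k) 0 0 m) (literalCost n)
    run-literal {e} {c} {x} {p} {g} {l} {s} {k} {m} v b v≤n at-v at-b p≤V B =
      run-seq
        (subst (λ a → Run literalStart _ (st e c x (p + 1) g (suc l) s k a x m) (size literalStart))
          (read-At at-v) (straight literalStart B))
        (run-seq (run-mono (loopSteps-mono {3} ≤-refl v≤n) (run-shift v x B′))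
          (subst (λ a → Run literalEnd _ (st e c x (p + 1 + 1) g l s (literalVal (shift v x) a k) 0 0 m)
                          (size literalEnd))
            (read-At at-b)
            (straight literalEnd (upd rv z≤n (upd ry (≤-trans (shift≤ v x) (get≤ B rx)) B′)))))
      where
      B′ : Bounded V (st e c x (p + 1) g (suc l) s k v x m)
      B′ = upd rp p≤V (upd rv (All-At at-v (mem≤ B)) (upd ry (get≤ B rx) B))

    run-literals : ∀ {e c x p g s k m rest} (C : Clause n) →
      Seg m p (concatMap encodeLiteral C ++ rest) →
      up p (length (concatMap encodeLiteral C)) ≤ V →
      Bounded V (st e c x p g (length C) s k 0 0 m) →
      Run (whilenz rl literalBody) (st e c x p g (length C) s k 0 0 m)
        (st e c x (up p (length (concatMap encodeLiteral C))) g 0 s (clauseVal x k C) 0 0 m)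
        (loopSteps (literalCost n) (length C))
    run-literals [] _ _ B = run-stop B refl
    run-literals {x = x} {p = p} {k = k} (ℓ ∷ C) (at-v , at-b , seg) ≤V B =
      run-step B (λ ())
        (run-literal (toℕ (var ℓ)) (bit (sign ℓ)) (<⇒≤ (toℕ<n (var ℓ))) at-v at-b
          (≤-trans (m≤m+n (p + 1) 1) p≤V) B)
        (run-literals C seg ≤V
          (upd rp p≤V (upd rl (≤-trans (n≤1+n _) (get≤ B rl))
            (upd rk (≤-trans (literalVal≤1 (shift (toℕ (var ℓ)) x) (bit (sign ℓ)) k) 1≤V) B))))
      where
      p≤V : p + 1 + 1 ≤ V
      p≤V = ≤-trans (m≤m+n (p + 1 + 1) _)
        (≤-trans (≤-reflexive (sym (up-+ (p + 1 + 1) (length (concatMap encodeLiteral C))))) ≤V)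

    clauseVal≤1 : ∀ x k (C : Clause n) → k ≤ 1 → clauseVal x k C ≤ 1
    clauseVal≤1 x k []      k≤1 = k≤1
    clauseVal≤1 x k (ℓ ∷ C) k≤1 =
      clauseVal≤1 x _ C (literalVal≤1 (shift (toℕ (var ℓ)) x) (bit (sign ℓ)) k)

    run-clauses : ∀ {w e c x p s m} (F : CNF n) → IsKCNF w F →
      Seg m p (concatMap encodeClause F) → f ≡ up p (length (concatMap encodeClause F)) →
      Bounded V (st e c x p (f ∸ p) 0 s 0 0 0 m) →
      Run (whilenz rg clauseBody) (st e c x p (f ∸ p) 0 s 0 0 0 m)
        (st e c x f 0 0 (cnfVal x s F) 0 0 0 m) (loopSteps (clauseCost n w) (length F))
    run-clauses {e = e} {c} {x} {s = s} {m} [] _ _ refl B =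
      subst (λ g → Run (whilenz rg clauseBody) (st e c x f (f ∸ f) 0 s 0 0 0 m)
                     (st e c x f g 0 s 0 0 0 m) 1)
        (n∸n≡0 f) (run-stop B (n∸n≡0 f))
    run-clauses {w} {e} {c} {x} {p} {s} {m} (C ∷ F) (C≤w ∷ F≤w) (at , seg) f≡ B =
      -- Even an empty clause occupies the cell of its length, so unread cells remain as long as
      -- clauses remain.
      run-step B (λ e → <⇒≱ p<f (m∸n≡0⇒m≤n e))
        (run-seq
          (subst (λ l → Run clauseStart (st e c x p (f ∸ p) 0 s 0 0 0 m)
                          (st e c x (p + 1) (f ∸ p) l s 0 0 0 m) (size clauseStart))
            (read-At at) (straight clauseStart B))
          (run-seq
            (run-mono (loopSteps-mono {literalCost n} ≤-refl C≤w)
              (run-literals C seg q≤V (upd rp p≤V (upd rl (All-At at (mem≤ B)) B))))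
            (straight clauseEnd
              (upd rp q≤V (upd rk (≤-trans (clauseVal≤1 x 0 C z≤n) 1≤V) B)))))
        (run-clauses F F≤w (Seg-drop (concatMap encodeLiteral C) seg) f≡q
          (upd rp q≤V (upd rg (≤-trans (m∸n≤m f q) (get≤ B rf))
            (upd rs (≤-trans (m∸n≤m s (1 ∸ clauseVal x 0 C)) (get≤ B rs)) B))))
      where
      open ≤-Reasoning
      as = concatMap encodeLiteral C
      bs = concatMap encodeClause F
      q  = up (p + 1) (length as)
      f≡q : f ≡ up q (length bs)
      f≡q = begin-equality
        f                                     ≡⟨ f≡ ⟩
        up (p + 1) (length (as ++ bs))        ≡⟨ up-+ (p + 1) (length (as ++ bs)) ⟩
        p + 1 + length (as ++ bs)             ≡⟨ cong (p + 1 +_) (length-++ as) ⟩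
        p + 1 + (length as + length bs)       ≡⟨ +-assoc (p + 1) (length as) (length bs) ⟨
        p + 1 + length as + length bs         ≡⟨ cong (_+ length bs) (up-+ (p + 1) (length as)) ⟨
        q + length bs                         ≡⟨ up-+ q (length bs) ⟨
        up q (length bs)                      ∎
      q≤f : q ≤ f
      q≤f = ≤-trans (m≤m+n q (length bs)) (≤-reflexive (trans (sym (up-+ q (length bs))) (sym f≡q)))
      q≤V : q ≤ V
      q≤V = ≤-trans q≤f (get≤ B rf)
      p+1≤q : p + 1 ≤ q
      p+1≤q = ≤-trans (m≤m+n (p + 1) (length as)) (≤-reflexive (sym (up-+ (p + 1) (length as))))
      p≤V : p + 1 ≤ V
      p≤V = ≤-trans p+1≤q q≤V
      p<f : p < f
      p<f = ≤-trans (≤-reflexive (+-comm 1 p)) (≤-trans p+1≤q q≤f)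

    module _ {M : List ℕ} (M≤V : All (_≤ V) M) (∣M∣≤V : length M ≤ V) where

      -- `M` is the memory at the end of a phase that only appends. Every memory on the way is a
      -- prefix of it, so bounds proved once for `M` serve throughout.
      prefixMem : ∀ {r} {s : State r} {m} r′ → m ++ r′ ≡ M → Bounded V s → Bounded V ⟪ regs s , m ⟫
      prefixMem {m = m} r′ refl = updMem (++⁻ˡ m M≤V)
        (≤-trans (m≤m+n (length m) (length r′)) (≤-trans (≤-reflexive (sym (length-++ m))) ∣M∣≤V))

      prefix-length≤ : ∀ m r′ → m ++ r′ ≡ M → length m ≤ V
      prefix-length≤ m r′ refl =
        ≤-trans (m≤m+n (length m) (length r′)) (≤-trans (≤-reflexive (sym (length-++ m))) ∣M∣≤V)

      open Tables N
      open Layout N H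

      eval-rowEnd : ∀ c x p m w → eval rowEnd (st (length m) (suc c) x p 0 0 w 0 0 0 m) ≡
        st (length (m ∷ʳ entry x w)) c (x + 1) 0 0 0 0 0 0 0 (m ∷ʳ entry x w)
      eval-rowEnd c x p m zero =
        cong₂ (λ e m′ → st e c (x + 1) 0 0 0 0 0 0 0 m′) (sym (length-++ m)) (write-length m 0)
      eval-rowEnd c x p m (suc _) =
        cong₂ (λ e m′ → st e c (x + 1) 0 0 0 0 0 0 0 m′) (sym (length-++ m)) (write-length m (N + x))

      run-rows : ∀ {w} (F : CNF n) → IsKCNF w F → f ≡ up 2 (length (concatMap encodeClause F)) →
        ∀ c x m → Seg m 2 (concatMap encodeClause F) → m ++ map (table F) (count x c) ≡ M →
        x + c ≤ V →
        Bounded V (st (length m) c x 0 0 0 0 0 0 0 m) →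
        Run (whilenz rc rowBody) (st (length m) c x 0 0 0 0 0 0 0 m)
          (st (length M) 0 (up x c) 0 0 0 0 0 0 0 M) (loopSteps (rowCost n w (length F)) c)
      run-rows F F≤w f≡ zero x m seg m≡M x≤V B
        with refl ← trans (sym (++-identityʳ m)) m≡M = run-stop B refl
      run-rows {w} F F≤w f≡ (suc c) x m seg m≡M x≤V B =
        run-step B (λ ())
          (run-seq (straight rowStart B)
            (run-seq
              (run-clauses F F≤w seg f≡
                (upd rp 2≤V (upd rg (≤-trans (m∸n≤m f 2) (get≤ B rf)) (upd rs 1≤V B))))
              (subst (λ s → Run rowEnd (st (length m) (suc c) x f 0 0 (cnfVal x 1 F) 0 0 0 m) s (size rowEnd))
                (eval-rowEnd c x f m (cnfVal x 1 F))
                (straight rowEnd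
                  (upd rp (get≤ B rf) (upd rs (≤-trans (cnfVal≤ x 1 F) 1≤V) B))))))
          (run-rows F F≤w f≡ c (x + 1) m′ (Seg-++ (concatMap encodeClause F) _ seg) m′≡M x≤V′
            (prefixMem _ m′≡M
              (upd re (prefix-length≤ m′ _ m′≡M) (upd rc (≤-trans (n≤1+n c) (get≤ B rc))
                (upd rx (≤-trans (m≤m+n (x + 1) c) x≤V′) B)))))
        where
        m′ = m ∷ʳ table F x
        m′≡M : m′ ++ map (table F) (count (x + 1) c) ≡ M
        m′≡M = trans (++-assoc m _ _) m≡M
        x≤V′ : x + 1 + c ≤ V
        x≤V′ = ≤-trans (≤-reflexive (+-assoc x 1 c)) x≤V
        cnfVal≤ : ∀ {n} x s (F : CNF n) → cnfVal x s F ≤ s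
        cnfVal≤ x s []      = ≤-refl
        cnfVal≤ x s (C ∷ F) = ≤-trans (cnfVal≤ x _ F) (m∸n≤m s (1 ∸ clauseVal x 0 C))

      run-mix : ∀ {c} h as bs p m → length as ≡ h → length bs ≡ h →
        Seg m p as → Seg m (p + H) bs → ∀ r → m ++ mix as bs ++ r ≡ M →
        up p h ≤ V →
        Bounded V (st (length m) c 0 p 0 h 0 0 0 0 m) →
        Run (whilenz rl mixBody) (st (length m) c 0 p 0 h 0 0 0 0 m)
          (st (length (m ++ mix as bs)) c 0 (up p h) 0 0 0 0 0 0 (m ++ mix as bs))
          (loopSteps (size mixBody) h)
      run-mix {c} zero [] [] p m _ _ _ _ r m≡M ≤V B =
        subst (λ m′ → Run (whilenz rl mixBody) (st (length m) c 0 p 0 0 0 0 0 0 m)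
                        (st (length m′) c 0 p 0 0 0 0 0 0 m′) 1)
          (sym (++-identityʳ m)) (run-stop B refl)
      run-mix {c} (suc h) (a ∷ as) (b ∷ bs) p m las lbs (at-a , seg-a) (at-b , seg-b) r m≡M ≤V B =
        run-step B (λ ())
          (subst (λ s → Run mixBody (st (length m) c 0 p 0 (suc h) 0 0 0 0 m) s (size mixBody))
            eval≡ (straight mixBody B))
          (subst (λ m″ → Run (whilenz rl mixBody) (st (length m′) c 0 (p + 1) 0 h 0 0 0 0 m′)
                           (st (length m″) c 0 (up (p + 1) h) 0 0 0 0 0 0 m″)
                           (loopSteps (size mixBody) h))
            (++-assoc m _ (mix as bs))
            (run-mix h as bs (p + 1) m′ (suc-injective las) (suc-injective lbs)
              (Seg-++ as _ seg-a)
              (subst (λ q → Seg m′ q bs) (swap p H) (Seg-++ bs _ seg-b))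
              r m′≡M ≤V
              (prefixMem _ m′≡M
                (upd re (prefix-length≤ m′ _ m′≡M) (upd rp p≤V (upd rl (≤-trans (n≤1+n h) (get≤ B rl)) B))))))
        where
        m′ = m ++ (a ⊕ b) ∷ (b ⊕ a) ∷ []
        swap : ∀ p H → p + H + 1 ≡ p + 1 + H
        swap p H = trans (+-assoc p H 1) (trans (cong (p +_) (+-comm H 1)) (sym (+-assoc p 1 H)))
        m′≡M : m′ ++ mix as bs ++ r ≡ M
        m′≡M = trans (++-assoc m _ (mix as bs ++ r)) m≡M
        p≤V : p + 1 ≤ V
        p≤V = ≤-trans (m≤m+n (p + 1) h) (≤-trans (≤-reflexive (sym (up-+ (p + 1) h))) ≤V)
        eval≡ : eval mixBody (st (length m) c 0 p 0 (suc h) 0 0 0 0 m) ≡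
          st (length m′) c 0 (p + 1) 0 h 0 0 0 0 m′
        eval≡ rewrite read-At at-a | read-At at-b =
          cong₂ (λ e m″ → st e c 0 (p + 1) 0 h 0 0 0 0 m″)
            (trans (+-assoc (length m) 1 1) (sym (length-++ m)))
            (write₂-length m (a ⊕ b) (b ⊕ a))

      -- `Q` is all that precedes the current table `t`: reading starts at `length Q`, and the next
      -- table is written from `length m` on.
      run-layers : ∀ c t Q m → (c ≡ 0 ⊎ length t ≡ H + H) → m ≡ Q ++ t → m ++ grow c t ≡ M →
        Bounded V (st (length m) c 0 (length Q) 0 0 0 0 0 0 m) →
        Run (whilenz rc layerBody) (st (length m) c 0 (length Q) 0 0 0 0 0 0 m)
          (st (length M) 0 0 (lastTable (length Q) c) 0 0 0 0 0 0 M) (loopSteps (layerCost H) c)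
      run-layers zero t Q m _ _ m≡M B
        with refl ← trans (sym (++-identityʳ m)) m≡M = run-stop B refl
      run-layers (suc c) t Q m (inj₂ lt) m≡ m≡M B =
        run-step B (λ ())
          (run-seq (straight layerStart B)
            (run-seq
              (run-mix H (take H t) (drop H t) p m lt₁ lt₂ seg₁ seg₂ (grow c (layer H t)) m≡M up≤V
                (upd rl (get≤ B rH) B))
              (straight layerEnd
                (prefixMem _ m′≡M (upd re (prefix-length≤ m′ _ m′≡M) (upd rp up≤V B))))))
          (subst (λ q → Run (whilenz rc layerBody) (st (length m′) c 0 q 0 0 0 0 0 0 m′)
                          (st (length M) 0 0 (lastTable q c) 0 0 0 0 0 0 M) (loopSteps (layerCost H) c))
            (sym p≡)
            (run-layers c (layer H t) m m′ (inj₂ (length-layer t lt)) refl m′≡M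
              (prefixMem _ m′≡M
                (upd re (prefix-length≤ m′ _ m′≡M) (upd rp (length≤ B) (upd rc (≤-trans (n≤1+n c) (get≤ B rc)) B))))))
        where
        p  = length Q
        m′ = m ++ layer H t
        m′≡M : m′ ++ grow c (layer H t) ≡ M
        m′≡M = trans (++-assoc m _ _) m≡M
        lt₁ = length-take-H t lt
        lt₂ = length-drop-H t lt
        m≡′ : m ≡ Q ++ take H t ++ drop H t
        m≡′ = trans m≡ (cong (Q ++_) (sym (take++drop≡id H t)))
        seg : Seg m p (take H t ++ drop H t)
        seg = subst (λ m → Seg m p (take H t ++ drop H t))
          (trans (cong (Q ++_) (++-identityʳ _)) (sym m≡′)) (Seg-length Q (take H t ++ drop H t) [])
        seg₁ : Seg m p (take H t)
        seg₁ = subst (λ m → Seg m p (take H t)) (sym m≡′) (Seg-length Q (take H t) (drop H t))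
        seg₂ : Seg m (p + H) (drop H t)
        seg₂ = subst (λ q → Seg m q (drop H t))
          (trans (up-+ p (length (take H t))) (cong (p +_) lt₁)) (Seg-drop (take H t) seg)
        p≡ : up p H + H ≡ length m
        p≡ = trans (lastTable-length t Q lt) (cong length (sym m≡))
        up≤V : up p H ≤ V
        up≤V = ≤-trans (m≤m+n (up p H) H) (≤-trans (≤-reflexive p≡) (length≤ B))

      eval-scanBody : ∀ {e c x p g s k m} a b → At m g a → At m p b →
        eval scanBody (st e (suc c) x p g 0 s k 0 0 m) ≡
        (let (s′ , k′) = scanStep a b x (s , k) in st e c (x + 1) (p + 1) (g + 1) 0 s′ k′ 0 0 m)
      eval-scanBody zero b at-a _ rewrite read-At at-a = refl
      eval-scanBody {s = s} (suc a) b at-a at-b rewrite read-At at-a | read-At at-b with b ∸ s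
      ... | zero  = refl
      ... | suc _ = refl

      scanStep-≤ : ∀ {s k} a b x → b ≤ V → x ≤ V → s ≤ V → k ≤ V →
        let (s′ , k′) = scanStep a b x (s , k) in s′ ≤ V × k′ ≤ V
      scanStep-≤         zero    b x b≤ x≤ s≤ k≤ = s≤ , k≤
      scanStep-≤ {s} (suc _) b x b≤ x≤ s≤ k≤ with b ∸ s
      ... | zero  = s≤ , k≤
      ... | suc _ = b≤ , x≤

      run-scan : ∀ {e m} c as bs x p g s k → length as ≡ c → length bs ≡ c →
        Seg m g as → Seg m p bs → x + c ≤ V → g + c ≤ V → p + c ≤ V →
        Bounded V (st e c x p g 0 s k 0 0 m) →
        let (s′ , k′) = scan x as bs (s , k) in
        Run (whilenz rc scanBody) (st e c x p g 0 s k 0 0 m)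
          (st e 0 (up x c) (up p c) (up g c) 0 s′ k′ 0 0 m) (loopSteps (size scanBody) c)
      run-scan zero [] [] x p g s k _ _ _ _ _ _ _ B = run-stop B refl
      run-scan {e} {m} (suc c) (a ∷ as) (b ∷ bs) x p g s k las lbs (at-a , seg-a) (at-b , seg-b) x≤ g≤ p≤ B =
        run-step B (λ ())
          (subst (λ s′ → Run scanBody (st e (suc c) x p g 0 s k 0 0 m) s′ (size scanBody))
            (eval-scanBody a b at-a at-b) (straight scanBody B))
          (run-scan c as bs (x + 1) (p + 1) (g + 1) _ _ (suc-injective las) (suc-injective lbs) seg-a seg-b
            (next x x≤) (next g g≤) (next p p≤)
            (upd rc (≤-trans (n≤1+n c) (get≤ B rc)) (upd rx (now x x≤) (upd rp (now p p≤) (upd rg (now g g≤)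
              (upd rs (proj₁ sk) (upd rk (proj₂ sk) B)))))))
        where
        next : ∀ y → y + suc c ≤ V → y + 1 + c ≤ V
        next y = ≤-trans (≤-reflexive (+-assoc y 1 c))
        now : ∀ y → y + suc c ≤ V → y + 1 ≤ V
        now y y≤ = ≤-trans (m≤m+n (y + 1) c) (next y y≤)
        sk = scanStep-≤ a b x (All-At at-b (mem≤ B)) (get≤ B rx) (get≤ B rs) (get≤ B rk)

      scan-≤ : ∀ c as bs x {s k} → length bs ≡ c → All (_≤ V) bs → x + c ≤ V → s ≤ V → k ≤ V →
        let (s′ , k′) = scan x as bs (s , k) in s′ ≤ V × k′ ≤ V
      scan-≤ c       []       bs       x _   _           _  s≤ k≤ = s≤ , k≤
      scan-≤ c       (_ ∷ _)  []       x _   _           _  s≤ k≤ = s≤ , k≤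
      scan-≤ (suc c) (a ∷ as) (b ∷ bs) x lbs (b≤ ∷ bs≤) x≤ s≤ k≤ =
        scan-≤ c as bs (x + 1) (suc-injective lbs) bs≤ (≤-trans (≤-reflexive (+-assoc x 1 c)) x≤)
          (proj₁ sk) (proj₂ sk)
        where sk = scanStep-≤ a b x b≤ (≤-trans (m≤m+n x (suc c)) x≤) s≤ k≤

    run-output : ∀ {e x g s k} c p y m → p + c ≤ V → Bounded V (st e c x p g 0 s k 0 y m) →
      Run (whilenz rc outputBody) (st e c x p g 0 s k 0 y m)
        (st e 0 x (up p c) g 0 s k 0 (shift c y) (writes p (lowBits c y) m))
        (loopSteps (size outputBody) c)
    run-output zero p y m p≤ B = run-stop B refl
    run-output (suc c) p y m p≤ B =
      run-step B (λ ()) (straight outputBody B)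
        (run-output c (p + 1) ⌊ y /2⌋ (write m p (lowBit y)) p≤′
          (updMem (write≤ p (≤-trans (lowBit≤1 y) 1≤V) (mem≤ B))
            (length-write≤ m p (lowBit y) (≤-trans (≤-reflexive (+-comm 1 p)) p<) (length≤ B))
            (upd rc (≤-trans (n≤1+n c) (get≤ B rc)) (upd rp p< (upd ry (≤-trans (⌊n/2⌋≤n y) (get≤ B ry)) B)))))
      where
      p≤′ : p + 1 + c ≤ V
      p≤′ = ≤-trans (≤-reflexive (+-assoc p 1 c)) p≤
      p< : p + 1 ≤ V
      p< = ≤-trans (m≤m+n (p + 1) c) p≤′

  run-powers : ∀ {n f e m} c N → N * 2 ^ c ≤ V → Bounded V (state n N 0 f e c 0 0 0 0 0 0 0 0 m) →
    Run (whilenz rc powerBody) (state n N 0 f e c 0 0 0 0 0 0 0 0 m)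
      (state n (N * 2 ^ c) 0 f e 0 0 0 0 0 0 0 0 0 m) (loopSteps (size powerBody) c)
  run-powers {n} {f} {e} {m} zero N N≤ B =
    subst (λ N′ → Run (whilenz rc powerBody) (state n N 0 f e 0 0 0 0 0 0 0 0 0 m)
                    (state n N′ 0 f e 0 0 0 0 0 0 0 0 0 m) 1)
      (sym (*-identityʳ N)) (run-stop B refl)
  run-powers {n} {f} {e} {m} (suc c) N N≤ B =
    run-step B (λ ()) (straight powerBody B)
      (subst (λ N′ → Run (whilenz rc powerBody) (state n (N + N) 0 f e c 0 0 0 0 0 0 0 0 m)
                       (state n N′ 0 f e 0 0 0 0 0 0 0 0 0 m) (loopSteps (size powerBody) c))
        (sym eq)
        (run-powers c (N + N) (≤-trans (≤-reflexive (sym eq)) N≤)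
          (upd rN N+N≤ (upd rc (≤-trans (n≤1+n c) (get≤ B rc)) B))))
    where
    eq : N * 2 ^ suc c ≡ (N + N) * 2 ^ c
    eq = trans (sym (*-assoc N 2 (2 ^ c)))
      (cong (_* 2 ^ c) (trans (*-comm N 2) (cong (N +_) (+-identityʳ N))))
    N+N≤ : N + N ≤ V
    N+N≤ = ≤-trans (m≤m*n (N + N) (2 ^ c) {{m^n≢0 2 c}}) (≤-trans (≤-reflexive (sym eq)) N≤)

-- Output

write-++ : ∀ P R w → ∃[ R′ ] write (P ++ R) (length P) w ≡ P ++ w ∷ R′
write-++ []      []      w = [] , refl
write-++ []      (_ ∷ R) w = R , refl
write-++ (a ∷ P) R       w with R′ , eq ← write-++ P R w = R′ , cong (a ∷_) eq

writes-++ : ∀ P ws R → ∃[ R′ ] writes (length P) ws (P ++ R) ≡ P ++ ws ++ R′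
writes-++ P []       R = R , refl
writes-++ P (w ∷ ws) R
  with R₁ , eq₁ ← write-++ P R w
  with R₂ , eq₂ ← writes-++ (P ∷ʳ w) ws R₁ = R₂ , (begin
    writes (length P + 1) ws (write (P ++ R) (length P) w)
      ≡⟨ cong₂ (λ p m → writes p ws m) (sym (length-++ P)) (trans eq₁ (sym (++-assoc P (w ∷ []) R₁))) ⟩
    writes (length (P ∷ʳ w)) ws ((P ∷ʳ w) ++ R₁)
      ≡⟨ eq₂ ⟩
    (P ∷ʳ w) ++ ws ++ R₂
      ≡⟨ ++-assoc P (w ∷ []) (ws ++ R₂) ⟩
    P ++ w ∷ ws ++ R₂ ∎)
  where open ≡-Reasoning

take-length-++ : ∀ (as bs : List ℕ) → take (length as) (as ++ bs) ≡ as
take-length-++ []       bs = refl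
take-length-++ (a ∷ as) bs = cong (a ∷_) (take-length-++ as bs)

output-∷ : ∀ {r} (s : State r) {l vs} → mem s ≡ l ∷ vs → output s ≡ take l vs
output-∷ s eq with mem s
output-∷ s refl | _ ∷ _ = refl

-- What remains behind the written cells is only known to exist; the prefix `c + c` makes `output`
-- stop exactly before it.
output-writes : ∀ {r} (s : State r) c m ws ws′ → length ws ≡ c → length ws′ ≡ c →
  mem s ≡ writes (up 1 c) ws′ (writes 1 ws (write m 0 (c + c))) → output s ≡ ws ++ ws′
output-writes s c m ws ws′ lws lws′ eq
  with R₁ , eq₁ ← write-++ [] m (c + c)
  with R₂ , eq₂ ← writes-++ ((c + c) ∷ []) ws R₁
  with R₃ , eq₃ ← writes-++ ((c + c) ∷ ws) ws′ R₂ = begin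
    output s                                 ≡⟨ output-∷ s mem≡ ⟩
    take (c + c) (ws ++ ws′ ++ R₃)           ≡⟨ cong₂ take length≡ (++-assoc ws ws′ R₃) ⟨
    take (length (ws ++ ws′)) ((ws ++ ws′) ++ R₃) ≡⟨ take-length-++ (ws ++ ws′) R₃ ⟩
    ws ++ ws′                                ∎
  where
  open ≡-Reasoning
  length≡ : length (ws ++ ws′) ≡ c + c
  length≡ = trans (length-++ ws) (cong₂ _+_ lws lws′)
  mem≡ : mem s ≡ (c + c) ∷ ws ++ ws′ ++ R₃
  mem≡ = begin
    mem s
      ≡⟨ eq ⟩
    writes (up 1 c) ws′ (writes 1 ws (write m 0 (c + c)))
      ≡⟨ cong₂ (λ p m → writes p ws′ m) (trans (up-+ 1 c) (cong suc (sym lws)))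
           (trans (cong (writes 1 ws) eq₁) eq₂) ⟩
    writes (suc (length ws)) ws′ ((c + c) ∷ ws ++ R₂)
      ≡⟨ eq₃ ⟩
    (c + c) ∷ ws ++ ws′ ++ R₃ ∎

-- Correctness

module Correct {n : ℕ} (F : CNF n) where

  N H : ℕ
  N = 2 ^ n
  H = ⌊ N /2⌋

  open Tables N
  open Layout N H

  T₀ Tₙ : Table
  T₀ w = table F (idx w)
  Tₙ = iterT n T₀

  -- For `n ≡ 0` the table has one entry and `H` is 0, so the equation fails; this is the origin of
  -- the alternative that the layout lemmas carry.
  halves : n ≡ 0 ⊎ N ≡ H + H
  halves = go n
    where
    go : ∀ n → n ≡ 0 ⊎ 2 ^ n ≡ ⌊ 2 ^ n /2⌋ + ⌊ 2 ^ n /2⌋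
    go zero    = inj₁ refl
    go (suc j) rewrite +-identityʳ (2 ^ j) | sym (n≡⌊n+n/2⌋ (2 ^ j)) = inj₂ refl

  first : map (table F) (count 0 N) ≡ map T₀ (words n)
  first = trans (cong (map (table F)) (sym (idx-words n))) (sym (map-∘ (words n)))

  -- `H` becomes the power `2 ^ j` required by `iterLayer-words` only after a case split on `n`. The
  -- split needs `n` generalised together with the parameter of `Tables`, which depends on it.
  last : iterLayer H n (map T₀ (words n)) ≡ map Tₙ (words n)
  last = go n T₀
    where
    go : ∀ n T → Tables.iterLayer (2 ^ n) ⌊ 2 ^ n /2⌋ n (map T (words n)) ≡
                 map (Tables.iterT (2 ^ n) n T) (words n)
    go zero    T = refl
    go (suc j) T = trans
      (cong (λ h → Tables.iterLayer (2 ^ suc j) h (suc j) (map T (words (suc j))))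
        (trans (cong (λ m → ⌊ 2 ^ j + m /2⌋) (+-identityʳ (2 ^ j))) (sym (n≡⌊n+n/2⌋ (2 ^ j)))))
      (Tables.iterLayer-words (2 ^ suc j) (suc j) T j)

  best : ℕ × ℕ
  best = scan 0 (map T₀ (words n)) (map Tₙ (words n)) (0 , 0)

  large : ∀ w → T₀ w ≡ 0 ⊎ N ≤ T₀ w
  large w with cnfVal (idx w) 1 F
  ... | zero  = inj₁ refl
  ... | suc _ = inj₂ (m≤m+n N (idx w))

  T₀-value : ∀ w → T₀ w ≢ 0 → T₀ w ≡ N + idx w
  T₀-value w ≢0 with cnfVal (idx w) 1 F
  ... | zero  = contradiction refl ≢0
  ... | suc _ = refl

  T₀-sat : ∀ z → T₀ (Vec.toList z) ≢ 0 → z ⊨ F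
  T₀-sat z ≢0 with cnfVal-reflects z F
  ... | inj₁ (p , _) = p
  ... | inj₂ (_ , e) = contradiction (cong (entry (index z)) e) ≢0

  N≤T₀ : ∀ z → z ⊨ F → N ≤ T₀ (Vec.toList z)
  N≤T₀ z p with cnfVal-reflects z F
  ... | inj₂ (¬p , _) = contradiction p ¬p
  ... | inj₁ (_ , e)  = ≤-trans (m≤m+n N (index z)) (≤-reflexive (sym (cong (entry (index z)) e)))

  N>0 : N > 0
  N>0 = m^n>0 2 n

  T₀≢0 : ∀ z → z ⊨ F → T₀ (Vec.toList z) ≢ 0
  T₀≢0 z p = m<n⇒n≢0 (≤-trans N>0 (N≤T₀ z p))

  Tₙ-upper : ∀ (z x : Assignment n) → z ⊨ F → N + index z + d_H x z * N ≤ Tₙ (Vec.toList x)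
  Tₙ-upper z x p = begin
    N + index z + d_H x z * N
      ≡⟨ cong₂ (λ t d → t + d * N) (T₀-value (Vec.toList z) (T₀≢0 z p)) (dist-d_H z x) ⟨
    T₀ (Vec.toList z) + dist (Vec.toList z) (Vec.toList x) * N
      ≤⟨ proj₁ (iterT-max T₀ large [] (Vec.toList x)) {Vec.toList z}
           (value (trans (length-toList z) (sym (length-toList x))) (T₀≢0 z p , refl)) ⟩
    iterT (length (Vec.toList x)) T₀ (Vec.toList x ++ [])
      ≡⟨ cong₂ (λ i w → iterT i T₀ w) (length-toList x) (++-identityʳ (Vec.toList x)) ⟩
    Tₙ (Vec.toList x) ∎
    where open ≤-Reasoning

  toVec : ∀ {m} (p : List Bool) → length p ≡ m → Σ[ z ∈ Assignment m ] p ≡ Vec.toList z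
  toVec []      refl = [] , refl
  toVec (b ∷ p) refl with z , eq ← toVec p refl = b ∷ z , cong (b ∷_) eq

  -- The satisfying `z` rules out the empty maximum: by `Tₙ-upper` the entry at `x` is at least
  -- `N > 0`.
  Tₙ-attained : ∀ (z x : Assignment n) → z ⊨ F →
    Σ[ y ∈ Assignment n ] y ⊨ F × Tₙ (Vec.toList x) ≡ N + index y + d_H x y * N
  Tₙ-attained z x p
    with proj₂ (iterT-max T₀ large [] (Vec.toList x))
       | cong₂ (λ i w → iterT i T₀ w) (length-toList x) (++-identityʳ (Vec.toList x))
  ... | inj₁ ≡0 | eq = contradiction (n≤0⇒n≡0 (≤-trans (Tₙ-upper z x p) (≤-reflexive (trans (sym eq) ≡0))))
                         (m<n⇒n≢0 (≤-trans N>0 (≤-trans (m≤m+n N (index z)) (m≤m+n _ _))))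
  ... | inj₂ (_ , q , value lq (≢0 , eq′)) | eq
    with y , refl ← toVec q (trans lq (length-toList x)) =
    y , T₀-sat y ≢0 ,
    trans (sym eq) (trans eq′ (cong₂ (λ t d → t + d * N) (T₀-value (Vec.toList y) ≢0) (dist-d_H y x)))

  -- The last two equations put the registers of the scan into the form that `lowBits-index`
  -- decodes; the distance survives only in the multiple of `N`.
  farthest : Satisfiable F →
    Σ[ z₁ ∈ Assignment n ] Σ[ z₂ ∈ Assignment n ]
      z₁ ∈ Ω F × z₂ ∈ Ω F × d_H z₁ z₂ ≡ Diam F ×
      proj₂ best ≡ index z₁ × proj₁ best ≡ index z₂ + N * suc (d_H z₁ z₂)
  farthest (z₀ , p₀)
    with _ , upper , witness ← scan-spec T₀ Tₙ 0 N (words n) (0 , 0) (idx-words n)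
    with witness
  -- The initial pair `(0 , 0)` cannot survive the scan, because the entry of `Tₙ` at `z₀` is
  -- positive.
  ... | inj₁ eq = contradiction
          (n≤0⇒n≡0 (≤-trans (Tₙ-upper z₀ z₀ p₀)
            (≤-trans (upper (∈-words z₀) (T₀≢0 z₀ p₀)) (≤-reflexive (cong proj₁ eq)))))
          (m<n⇒n≢0 (≤-trans N>0 (≤-trans (m≤m+n N (index z₀)) (m≤m+n _ _))))
  ... | inj₂ (w , w∈ , ≢0 , eq₁ , eq₂)
    with z₁ , refl ← ∈-words⁻ {n} w∈
    with z₂ , p₂ , attained ← Tₙ-attained z₀ z₁ p₀ =
    z₁ , z₂ , ∈Ω z₁ p₁ , ∈Ω z₂ p₂ , ≤-antisym d≤Diam Diam≤d , eq₂ , trans eq₁ (trans attained regroup′)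
    where
    p₁ : z₁ ⊨ F
    p₁ = T₀-sat z₁ ≢0
    ∈Ω : ∀ z → z ⊨ F → z ∈ Ω F
    ∈Ω z = Equivalence.from (∈Ω⇔⊨ F z)
    d = d_H z₁ z₂
    d≤Diam : d ≤ Diam F
    d≤Diam = v≤max⁺ 0 _ (inj₂ (Any.map ≤-reflexive (∈-cartesianProductWith⁺ d_H (∈Ω z₁ p₁) (∈Ω z₂ p₂))))
    regroup′ : N + index z₂ + d * N ≡ index z₂ + N * suc d
    regroup′ = begin
      N + index z₂ + d * N    ≡⟨ cong (_+ d * N) (+-comm N (index z₂)) ⟩
      index z₂ + N + d * N    ≡⟨ +-assoc (index z₂) N (d * N) ⟩
      index z₂ + suc d * N    ≡⟨ cong (index z₂ +_) (*-comm (suc d) N) ⟩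
      index z₂ + N * suc d    ∎
      where open ≡-Reasoning
    -- The tie-breaking index is below N, the unit of distance.
    pair≤ : ∀ x y → x ⊨ F → y ⊨ F → d_H x y ≤ d
    pair≤ x y px py = ≤-pred (*-cancelʳ-< N (d_H x y) (suc d) (+-cancelˡ-< N (d_H x y * N) (suc d * N) (begin-strict
      N + d_H x y * N                ≤⟨ +-monoˡ-≤ (d_H x y * N) (m≤m+n N (index y)) ⟩
      N + index y + d_H x y * N      ≤⟨ Tₙ-upper y x py ⟩
      Tₙ (Vec.toList x)              ≤⟨ upper (∈-words x) (T₀≢0 x px) ⟩
      proj₁ best                     ≡⟨ trans eq₁ attained ⟩
      N + index z₂ + d * N           ≡⟨ +-assoc N (index z₂) (d * N) ⟩
      N + (index z₂ + d * N)         <⟨ +-monoʳ-< N (+-monoˡ-< (d * N) index<) ⟩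
      N + suc d * N                  ∎)))
      where
      open ≤-Reasoning
      index< : index z₂ < N
      index< = <-≤-trans (idx< (Vec.toList z₂)) (≤-reflexive (cong (2 ^_) (length-toList z₂)))
    Diam≤d : Diam F ≤ d
    Diam≤d = max≤v⁺ z≤n (All.tabulate λ v∈ →
      let (x , y , x∈ , y∈ , eq) = ∈-cartesianProductWith⁻ d_H (Ω F) (Ω F) v∈ in
      ≤-trans (≤-reflexive eq)
        (pair≤ x y (Equivalence.to (∈Ω⇔⊨ F x) x∈) (Equivalence.to (∈Ω⇔⊨ F y) y∈)))

-- Sizes of the encoding and the run of the whole program

n≤2^n : ∀ n → n ≤ 2 ^ n
n≤2^n zero    = z≤n
n≤2^n (suc n) = begin
  suc n              ≤⟨ s≤s (n≤2^n n) ⟩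
  1 + 2 ^ n          ≤⟨ +-monoˡ-≤ (2 ^ n) (m^n>0 2 n) ⟩
  2 ^ n + 2 ^ n      ≡⟨ cong (2 ^ n +_) (+-identityʳ (2 ^ n)) ⟨
  2 ^ suc n          ∎
  where open ≤-Reasoning

length-encodeClauses : ∀ {n w} (F : CNF n) → IsKCNF w F →
  length (concatMap encodeClause F) ≤ length F * suc (w + w)
length-encodeClauses []      []          = z≤n
length-encodeClauses {w = w} (C ∷ F) (C≤w ∷ F≤w) = begin
  length (encodeClause C ++ concatMap encodeClause F)
    ≡⟨ length-++ (encodeClause C) ⟩
  suc (length (concatMap encodeLiteral C)) + length (concatMap encodeClause F)
    ≤⟨ +-mono-≤ (s≤s (≤-trans (≤-reflexive (length-literals C)) (+-mono-≤ C≤w C≤w)))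
                (length-encodeClauses F F≤w) ⟩
  suc (w + w) + length F * suc (w + w) ∎
  where
  open ≤-Reasoning
  length-literals : ∀ {n} (C : Clause n) → length (concatMap encodeLiteral C) ≡ length C + length C
  length-literals []      = refl
  length-literals (ℓ ∷ C) = cong suc (trans (cong suc (length-literals C)) (sym (+-suc (length C) (length C))))

bit≤1 : ∀ b → bit b ≤ 1
bit≤1 false = z≤n
bit≤1 true  = s≤s z≤n

encodeClauses-≤ : ∀ {n w V} (F : CNF n) → IsKCNF w F → n ≤ V → w ≤ V → 1 ≤ V →
  All (_≤ V) (concatMap encodeClause F)
encodeClauses-≤ []      []          n≤V w≤V 1≤V = []
encodeClauses-≤ {V = V} (C ∷ F) (C≤w ∷ F≤w) n≤V w≤V 1≤V =
  ≤-trans C≤w w≤V ∷ ++⁺ (literals C) (encodeClauses-≤ F F≤w n≤V w≤V 1≤V)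
  where
  literals : ∀ C → All (_≤ V) (concatMap encodeLiteral C)
  literals []      = []
  literals (ℓ ∷ C) = ≤-trans (<⇒≤ (toℕ<n (var ℓ))) n≤V ∷ ≤-trans (bit≤1 (sign ℓ)) 1≤V ∷ literals C

writes-≤ : ∀ {V} p ws m → All (_≤ V) ws → p + length ws ≤ V → All (_≤ V) m → length m ≤ V →
  All (_≤ V) (writes p ws m) × length (writes p ws m) ≤ V
writes-≤ p []       m _            _  m≤ l≤ = m≤ , l≤
writes-≤ {V} p (w ∷ ws) m (w≤ ∷ ws≤) p≤ m≤ l≤ =
  writes-≤ (p + 1) ws (write m p w) ws≤ (≤-trans (≤-reflexive (+-assoc p 1 _)) p≤)
    (write≤ p w≤ m≤) (length-write≤ m p w p<V l≤)
  where
  p<V : p < V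
  p<V = ≤-trans (s≤s (m≤m+n p _)) (≤-trans (≤-reflexive (sym (+-suc p _))) p≤)

lowBits-≤ : ∀ c y → All (_≤ 1) (lowBits c y)
lowBits-≤ zero    y = []
lowBits-≤ (suc c) y = lowBit≤1 y ∷ lowBits-≤ c ⌊ y /2⌋

module Execution (ℓ V : ℕ) (32≤ℓ : 32 ≤ ℓ) {n w : ℕ} (F : CNF n) (F≤w : IsKCNF w F) where

  open Correct F

  code : List ℕ
  code = concatMap encodeClause F

  xs m₀ M₁ M₂ t₀ : List ℕ
  xs = encodeCNF F
  m₀ = length xs ∷ xs
  t₀ = map (Layout.table N H F) (count 0 N)
  M₁ = m₀ ++ t₀
  M₂ = M₁ ++ Layout.grow N H n t₀

  f : ℕ
  f = suc (length xs)

  -- The summands cover all numbers that occur at block entries: `f + (n * N + N)` is the final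
  -- length of the memory, `N + N + n * N` bounds the table entries, which gain at most `N` per
  -- layer, `w` bounds the clause lengths, and 4 the small constants.
  module _ (V-large : f + (n * N + (N + (N + N)) + (w + 4)) ≤ V) where

    open Tables N
    open Layout N H

    f+≤V : ∀ {a} → a ≤ n * N + (N + (N + N)) + (w + 4) → f + a ≤ V
    f+≤V a≤ = ≤-trans (+-monoʳ-≤ f a≤) V-large

    ≤V : ∀ {a} → a ≤ n * N + (N + (N + N)) + (w + 4) → a ≤ V
    ≤V {a} a≤ = ≤-trans (m≤n+m a f) (f+≤V a≤)

    f≤V : f ≤ V
    f≤V = ≤-trans (m≤m+n f 0) (f+≤V z≤n)

    w+4≤V : w + 4 ≤ V
    w+4≤V = ≤V (m≤n+m (w + 4) (n * N + (N + (N + N))))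

    2≤V : 2 ≤ V
    2≤V = ≤-trans (s≤s (s≤s z≤n)) (≤-trans (m≤n+m 4 w) w+4≤V)

    open Exec ℓ V 2≤V
    open Runs ℓ V 32≤ℓ 2≤V

    N≤ : N ≤ n * N + (N + (N + N)) + (w + 4)
    N≤ = ≤-trans (m≤m+n N (N + N)) (≤-trans (m≤n+m (N + (N + N)) (n * N)) (m≤m+n _ (w + 4)))

    nN+N≤ : n * N + N ≤ n * N + (N + (N + N)) + (w + 4)
    nN+N≤ = ≤-trans (+-monoʳ-≤ (n * N) (m≤m+n N (N + N))) (m≤m+n _ (w + 4))

    N≤V : N ≤ V
    N≤V = ≤V N≤

    n≤V : n ≤ V
    n≤V = ≤-trans (n≤2^n n) N≤V

    H≤V : H ≤ V
    H≤V = ≤-trans (⌊n/2⌋≤n N) N≤V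

    n*2H : n * (H + H) ≡ n * N
    n*2H with halves
    ... | inj₁ eq = trans (cong (_* (H + H)) eq) (cong (_* N) (sym eq))
    ... | inj₂ eq = cong (n *_) (sym eq)

    ∣t₀∣ : length t₀ ≡ N
    ∣t₀∣ = trans (length-map (table F) (count 0 N)) (length-count 0 N)

    even : n ≡ 0 ⊎ length t₀ ≡ H + H
    even with halves
    ... | inj₁ eq = inj₁ eq
    ... | inj₂ eq = inj₂ (trans ∣t₀∣ eq)

    m₀≤V : All (_≤ V) m₀
    m₀≤V = ≤-trans (n≤1+n _) f≤V ∷ n≤V ∷
      encodeClauses-≤ F F≤w n≤V (≤-trans (m≤m+n w 4) w+4≤V) 1≤V

    t₀≤ : All (_≤ N + N) t₀
    t₀≤ = map⁺ (entries 0 N ≤-refl)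
      where
      entry≤ : ∀ x → x ≤ N → table F x ≤ N + N
      entry≤ x x≤N with cnfVal x 1 F
      ... | zero  = z≤n
      ... | suc _ = +-monoʳ-≤ N x≤N
      entries : ∀ x c → x + c ≤ N → All (λ x → table F x ≤ N + N) (count x c)
      entries x zero    _  = []
      entries x (suc c) x≤ = entry≤ x (≤-trans (m≤m+n x (suc c)) x≤) ∷
        entries (x + 1) c (≤-trans (≤-reflexive (+-assoc x 1 c)) x≤)

    N+N+nN≤V : N + N + n * N ≤ V
    N+N+nN≤V = ≤V (≤-trans (≤-reflexive (+-comm (N + N) (n * N)))
      (≤-trans (+-monoʳ-≤ (n * N) (m≤n+m (N + N) N)) (m≤m+n _ (w + 4))))

    M₂≤V : All (_≤ V) M₂
    M₂≤V = ++⁺ (++⁺ m₀≤V (All.map (λ v → ≤-trans v (≤-trans (m≤m+n (N + N) (n * N)) N+N+nN≤V)) t₀≤))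
      (All.map (λ v → ≤-trans v N+N+nN≤V) (grow-≤ n t₀ t₀≤))

    ∣M₁∣ : length M₁ ≡ f + N
    ∣M₁∣ = trans (length-++ m₀) (cong (f +_) ∣t₀∣)

    ∣M₂∣ : length M₂ ≡ f + (n * N + N)
    ∣M₂∣ = begin
      length M₂                       ≡⟨ length-++ M₁ ⟩
      length M₁ + length (grow n t₀)  ≡⟨ cong₂ _+_ ∣M₁∣ (trans (length-grow n t₀ even) n*2H) ⟩
      f + N + n * N                   ≡⟨ +-assoc f N (n * N) ⟩
      f + (N + n * N)                 ≡⟨ cong (f +_) (+-comm N (n * N)) ⟩
      f + (n * N + N)                 ∎
      where open ≡-Reasoning

    ∣M₁∣≤V : length M₁ ≤ V
    ∣M₁∣≤V = ≤-trans (≤-reflexive ∣M₁∣) (f+≤V N≤)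

    ∣M₂∣≤V : length M₂ ≤ V
    ∣M₂∣≤V = ≤-trans (≤-reflexive ∣M₂∣) (f+≤V nN+N≤)

    q : ℕ
    q = lastTable f n

    q+N≤V : q + N ≤ V
    q+N≤V = ≤-trans (≤-reflexive (trans (cong (_+ N) (trans (lastTable-≡ f n) (cong (f +_) n*2H)))
      (+-assoc f (n * N) N))) (f+≤V nN+N≤)

    last-segment : Seg M₂ q (map Tₙ (words n))
    last-segment = subst (Seg M₂ q)
      (trans (cong (iterLayer H n) first) last)
      (Seg-lastTable n t₀ m₀ even)

    first-segment : Seg M₂ f (map T₀ (words n))
    first-segment = subst₂ (λ m t → Seg m f t) (sym (++-assoc m₀ t₀ (grow n t₀))) first
      (Seg-length m₀ t₀ (grow n t₀))

    code-segment : Seg m₀ 2 code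
    code-segment = subst (λ m → Seg m 2 code) (cong (λ c → length xs ∷ n ∷ c) (++-identityʳ code))
      (Seg-length (length xs ∷ n ∷ []) code [])

    ∣words∣ : ∀ (T : Table) → length (map T (words n)) ≡ N
    ∣words∣ T = trans (length-map T (words n)) (length-words n)

    1+n+n≤V : 1 + n + n ≤ V
    1+n+n≤V = ≤V (begin
      1 + n + n                                ≡⟨ +-comm 1 (n + n) ⟩
      n + n + 1                                ≤⟨ +-mono-≤ (+-mono-≤ (n≤2^n n) (n≤2^n n)) (≤-trans (s≤s z≤n) (m≤n+m 4 w)) ⟩
      N + N + (w + 4)                          ≤⟨ +-monoˡ-≤ (w + 4) (≤-trans (m≤n+m (N + N) N) (m≤n+m _ (n * N))) ⟩
      n * N + (N + (N + N)) + (w + 4)          ∎)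
      where open ≤-Reasoning

    arg val : ℕ
    arg = proj₂ best
    val = proj₁ best

    val≤V,arg≤V : val ≤ V × arg ≤ V
    val≤V,arg≤V = scan-≤ {n} {N} {H} {f} M₂≤V ∣M₂∣≤V N (map T₀ (words n)) (map Tₙ (words n)) 0 (∣words∣ Tₙ)
      (All-Seg (map Tₙ (words n)) last-segment M₂≤V) N≤V z≤n z≤n

    O₀ O₁ O₂ : List ℕ
    O₀ = write M₂ 0 (n + n)
    O₁ = writes 1 (lowBits n arg) O₀
    O₂ = writes (up 1 n) (lowBits n val) O₁

    n+n≤V : n + n ≤ V
    n+n≤V = ≤-trans (n≤1+n (n + n)) 1+n+n≤V

    O₀≤ : All (_≤ V) O₀ × length O₀ ≤ V
    O₀≤ = write≤ 0 n+n≤V M₂≤V , length-write≤ M₂ 0 (n + n) 1≤V ∣M₂∣≤V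

    O₁≤ : All (_≤ V) O₁ × length O₁ ≤ V
    O₁≤ = writes-≤ 1 (lowBits n arg) O₀ (All.map (λ v → ≤-trans v 1≤V) (lowBits-≤ n arg))
      (≤-trans (≤-reflexive (cong suc (length-lowBits n arg))) (≤-trans (m≤m+n (1 + n) n) 1+n+n≤V))
      (proj₁ O₀≤) (proj₂ O₀≤)

    up≤V : ∀ p c → p + c ≤ V → up p c ≤ V
    up≤V p c = ≤-trans (≤-reflexive (up-+ p c))

    -- The bounds at the states between the phases. After `B₁`, each comes from its predecessor by
    -- replacing just the registers and the memory that the phase changes.
    B₀ : Bounded V (initial {17} xs)
    B₀ = bounded (z≤n ∷ z≤n ∷ z≤n ∷ z≤n ∷ z≤n ∷ z≤n ∷ z≤n ∷ z≤n ∷ z≤n ∷ z≤n ∷ z≤n ∷ z≤n ∷ z≤n ∷ z≤n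
      ∷ z≤n ∷ z≤n ∷ z≤n ∷ []) m₀≤V f≤V

    B₁ : Bounded V (state n 1 0 f f n 0 0 0 0 0 0 0 0 m₀)
    B₁ = bounded (1≤V ∷ n≤V ∷ 1≤V ∷ z≤n ∷ f≤V ∷ f≤V ∷ n≤V ∷ z≤n ∷ z≤n ∷ z≤n ∷ z≤n ∷ z≤n ∷ z≤n ∷ z≤n
      ∷ z≤n ∷ z≤n ∷ z≤n ∷ []) m₀≤V f≤V

    B₂ : Bounded V (state n N 0 f f 0 0 0 0 0 0 0 0 0 m₀)
    B₂ = upd rN N≤V (upd rc z≤n B₁)

    B₃ : Bounded V (state n N H f f N 0 0 0 0 0 0 0 0 m₀)
    B₃ = upd rH H≤V (upd rc N≤V B₂)

    B₄ : Bounded V (state n N H f (length M₁) 0 (up 0 N) 0 0 0 0 0 0 0 M₁)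
    B₄ = updMem (++⁻ˡ M₁ M₂≤V) ∣M₁∣≤V (upd re ∣M₁∣≤V (upd rc z≤n (upd rx (up≤V 0 N N≤V) B₃)))

    B₅ : Bounded V (state n N H f (length M₁) n 0 f 0 0 0 0 0 0 M₁)
    B₅ = upd rx z≤n (upd rp f≤V (upd rc n≤V B₄))

    B₆ : Bounded V (state n N H f (length M₂) 0 0 q 0 0 0 0 0 0 M₂)
    B₆ = updMem M₂≤V ∣M₂∣≤V (upd re ∣M₂∣≤V (upd rc z≤n (upd rp (≤-trans (m≤m+n q N) q+N≤V) B₅)))

    B₇ : Bounded V (state n N H f (length M₂) N 0 q f 0 0 0 0 0 M₂)
    B₇ = upd rg f≤V (upd rc N≤V B₆)

    B₈ : Bounded V (state n N H f (length M₂) 0 (up 0 N) (up q N) (up f N) 0 val arg 0 0 M₂)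
    B₈ = upd rc z≤n (upd rx (up≤V 0 N N≤V) (upd rp (up≤V q N q+N≤V) (upd rg (up≤V f N (f+≤V N≤))
      (upd rs (proj₁ val≤V,arg≤V) (upd rk (proj₂ val≤V,arg≤V) B₇)))))

    B₉ : Bounded V (state n N H f (length M₂) n (up 0 N) 1 (up f N) 0 val arg 0 arg O₀)
    B₉ = updMem (proj₁ O₀≤) (proj₂ O₀≤)
      (upd rc n≤V (upd rp 1≤V (upd ry (proj₂ val≤V,arg≤V) B₈)))

    B₁₀ : Bounded V (state n N H f (length M₂) 0 (up 0 N) (up 1 n) (up f N) 0 val arg 0 (shift n arg) O₁)
    B₁₀ = updMem (proj₁ O₁≤) (proj₂ O₁≤) (upd rc z≤n
      (upd rp (up≤V 1 n (≤-trans (m≤m+n (1 + n) n) 1+n+n≤V))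
        (upd ry (≤-trans (shift≤ n arg) (proj₂ val≤V,arg≤V)) B₉)))

    B₁₁ : Bounded V (state n N H f (length M₂) n (up 0 N) (up 1 n) (up f N) 0 val arg 0 val O₁)
    B₁₁ = upd rc n≤V (upd ry (proj₁ val≤V,arg≤V) B₁₀)

    run-initialize : Run initialize (initial xs) (state n 1 0 f f n 0 0 0 0 0 0 0 0 m₀) (size initialize)
    run-initialize = subst
      (λ f → Run initialize (initial xs) (state n 1 0 f f n 0 0 0 0 0 0 0 0 m₀) (size initialize))
      (+-comm (length xs) 1) (straight initialize B₀)

    run-power : Run (whilenz rc powerBody) (state n 1 0 f f n 0 0 0 0 0 0 0 0 m₀)
      (state n N 0 f f 0 0 0 0 0 0 0 0 0 m₀) (loopSteps (size powerBody) n)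
    run-power = subst
      (λ N′ → Run (whilenz rc powerBody) (state n 1 0 f f n 0 0 0 0 0 0 0 0 m₀)
                (state n N′ 0 f f 0 0 0 0 0 0 0 0 0 m₀) (loopSteps (size powerBody) n))
      (*-identityˡ N) (run-powers n 1 (≤-trans (≤-reflexive (*-identityˡ N)) N≤V) B₁)

    final : State 17
    final = state n N H f (length M₂) 0 (up 0 N) (up (up 1 n) n) (up f N) 0 val arg 0 (shift n val) O₂

    run-program : Run (body diameterProgram) (initial xs) final (steps n N H w (length F))
    run-program =
      run-seq run-initialize
      (run-seq run-power
      (run-seq (straight powerEnd B₂)
      (run-seq (run-rows (++⁻ˡ M₁ M₂≤V) ∣M₁∣≤V F F≤w (sym (up-+ 2 (length code))) N 0 m₀ code-segment refl N≤V B₃)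
      (run-seq (straight layersStart B₄)
      (run-seq (run-layers M₂≤V ∣M₂∣≤V n t₀ m₀ M₁ even refl refl B₅)
      (run-seq (straight scanStart B₆)
      (run-seq (run-scan M₂≤V ∣M₂∣≤V N (map T₀ (words n)) (map Tₙ (words n)) 0 q f 0 0
                 (∣words∣ T₀) (∣words∣ Tₙ) first-segment last-segment N≤V (f+≤V N≤) q+N≤V B₇)
      (run-seq (straight outputStart B₈)
      (run-seq (run-output n 1 arg O₀ (≤-trans (m≤m+n (1 + n) n) 1+n+n≤V) B₉)
      (run-seq (straight outputNext B₁₀)
               (run-output n (up 1 n) val O₁
                 (≤-trans (≤-reflexive (cong (_+ n) (up-+ 1 n))) 1+n+n≤V) B₁₁)))))))))))

-- Growth rates

poly-const : ∀ c → PolyBounded (λ _ → c)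
poly-const c = c , λ n → m≤m*n c (suc n ^ c) {{m^n≢0 (suc n) c}}

poly-id : PolyBounded (λ n → n)
poly-id = 1 , λ n → ≤-trans (n≤1+n n) (≤-reflexive (sym (trans (*-identityˡ _) (*-identityʳ (suc n)))))

poly-+ : ∀ {f g} → PolyBounded f → PolyBounded g → PolyBounded (λ n → f n + g n)
poly-+ {f} {g} (c , f≤) (d , g≤) = c + d , λ n → begin
  f n + g n
    ≤⟨ +-mono-≤ (f≤ n) (g≤ n) ⟩
  c * suc n ^ c + d * suc n ^ d
    ≤⟨ +-mono-≤ (*-monoʳ-≤ c (^-monoʳ-≤ (suc n) (m≤m+n c d))) (*-monoʳ-≤ d (^-monoʳ-≤ (suc n) (m≤n+m d c))) ⟩
  c * suc n ^ (c + d) + d * suc n ^ (c + d)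
    ≡⟨ *-distribʳ-+ (suc n ^ (c + d)) c d ⟨
  (c + d) * suc n ^ (c + d) ∎
  where open ≤-Reasoning

poly-* : ∀ {f g} → PolyBounded f → PolyBounded g → PolyBounded (λ n → f n * g n)
-- A single constant is both coefficient and exponent in `PolyBounded`. The product needs `c * d` as
-- coefficient and `c + d` as exponent; their sum dominates both.
poly-* {f} {g} (c , f≤) (d , g≤) = c * d + (c + d) , λ n → begin
  f n * g n
    ≤⟨ *-mono-≤ (f≤ n) (g≤ n) ⟩
  c * suc n ^ c * (d * suc n ^ d)
    ≡⟨ interchange c (suc n ^ c) d (suc n ^ d) ⟩
  c * d * (suc n ^ c * suc n ^ d)
    ≡⟨ cong (c * d *_) (^-distribˡ-+-* (suc n) c d) ⟨
  c * d * suc n ^ (c + d)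
    ≤⟨ *-mono-≤ (m≤m+n (c * d) (c + d)) (^-monoʳ-≤ (suc n) (m≤n+m (c + d) (c * d))) ⟩
  (c * d + (c + d)) * suc n ^ (c * d + (c + d)) ∎
  where
  open ≤-Reasoning
  interchange : ∀ a b c d → a * b * (c * d) ≡ a * c * (b * d)
  interchange = solve-∀

loopSteps-≡ : ∀ N c → loopSteps N c ≡ c * suc N + 1
loopSteps-≡ N zero    = refl
loopSteps-≡ N (suc c) = trans (cong (suc N +_) (loopSteps-≡ N c)) (sym (+-assoc (suc N) (c * suc N) 1))

poly-loopSteps : ∀ {f g} → PolyBounded f → PolyBounded g → PolyBounded (λ n → loopSteps (f n) (g n))
poly-loopSteps {f} {g} pf pg
  with c , ≤c ← poly-+ (poly-* pg (poly-+ (poly-const 1) pf)) (poly-const 1) =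
  c , λ n → ≤-trans (≤-reflexive (loopSteps-≡ (f n) (g n))) (≤c n)

poly-steps : ∀ w {m} → PolyBounded m → PolyBounded (λ n → steps n 1 1 w (m n))
poly-steps w pm =
  let p1 = poly-const 1
      literal = poly-+ (poly-const (size literalStart))
                  (poly-+ (poly-loopSteps (poly-const 3) poly-id) (poly-const (size literalEnd)))
      clause  = poly-+ (poly-const (size clauseStart))
                  (poly-+ (poly-loopSteps literal (poly-const w)) (poly-const (size clauseEnd)))
      row     = poly-+ (poly-const (size rowStart))
                  (poly-+ (poly-loopSteps clause pm) (poly-const (size rowEnd)))
      total   =
        poly-+ (poly-const (size initialize)) (poly-+ (poly-loopSteps (poly-const (size powerBody)) poly-id)
        (poly-+ (poly-const (size powerEnd)) (poly-+ (poly-loopSteps row p1)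
        (poly-+ (poly-const (size layersStart)) (poly-+ (poly-loopSteps (poly-const (layerCost 1)) poly-id)
        (poly-+ (poly-const (size scanStart)) (poly-+ (poly-loopSteps (poly-const (size scanBody)) p1)
        (poly-+ (poly-const (size outputStart)) (poly-+ (poly-loopSteps (poly-const (size outputBody)) poly-id)
        (poly-+ (poly-const (size outputNext)) (poly-loopSteps (poly-const (size outputBody)) poly-id)))))))))))
  in total

rowCost-mono : ∀ n w {q q′} → q ≤ q′ → rowCost n w q ≤ rowCost n w q′
rowCost-mono n w q≤ = +-monoʳ-≤ (size rowStart) (+-monoˡ-≤ (size rowEnd) (loopSteps-mono ≤-refl q≤))

module _ {N : ℕ} (1≤N : 1 ≤ N) where

  -- Wrapping the inequality in a record lets Agda infer `a` and `b`, which it could not read off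
  -- from the product `b * N`.
  record _≼_ (a b : ℕ) : Set where
    constructor scaled
    field
      ≼⇒≤ : a ≤ b * N

  open _≼_ public

  scale : ∀ a → a ≼ a
  scale a = scaled (m≤m*n a N {{>-nonZero 1≤N}})

  scale-+ : ∀ {a b c d} → a ≼ b → c ≼ d → (a + c) ≼ (b + d)
  scale-+ {b = b} {d = d} (scaled a≤) (scaled c≤) =
    scaled (≤-trans (+-mono-≤ a≤ c≤) (≤-reflexive (sym (*-distribʳ-+ N b d))))

  scale-loopSteps : ∀ {a b} c → a ≼ b → loopSteps a c ≼ loopSteps b c
  scale-loopSteps zero    a≼b = scale 1
  scale-loopSteps (suc c) a≼b = scale-+ (scale-+ (scale 1) a≼b) (scale-loopSteps c a≼b)

  scale-loopSteps-N : ∀ {a b h} → a ≤ b → h ≤ N → loopSteps a h ≼ loopSteps b 1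
  scale-loopSteps-N {a} {b} {h} a≤b h≤N = scaled (begin
    loopSteps a h                ≤⟨ loopSteps-mono a≤b h≤N ⟩
    loopSteps b N                ≡⟨ loopSteps-≡ b N ⟩
    N * suc b + 1           ≤⟨ +-mono-≤ (≤-reflexive (*-comm N (suc b))) (≼⇒≤ (scale 1)) ⟩
    suc b * N + 1 * N       ≡⟨ *-distribʳ-+ N (suc b) 1 ⟨
    loopSteps b 1 * N            ∎)
    where open ≤-Reasoning

  scale-layer : ∀ {h} → h ≤ N → layerCost h ≼ layerCost 1
  scale-layer h≤N =
    let loop  = scale-loopSteps-N {size mixBody} ≤-refl h≤N
        total = scale-+ (scale (size layerStart)) (scale-+ loop (scale (size layerEnd)))
    in total

  -- No loop of up to `N` rounds is nested in another such loop: the rows and the scan contain none,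
  -- and the layers repeat one only `n` times. So the factor `N` is paid once.
  scale-steps : ∀ n {H} w {q q′} → H ≤ N → q ≤ q′ → steps n N H w q ≼ steps n 1 1 w q′
  scale-steps n w H≤N q≤ =
    let rows   = scale-loopSteps-N (rowCost-mono n w q≤) ≤-refl
        scans  = scale-loopSteps-N {size scanBody} ≤-refl ≤-refl
        output = scale-loopSteps n (scale (size outputBody))
        total  =
          scale-+ (scale (size initialize)) (scale-+ (scale-loopSteps n (scale (size powerBody)))
          (scale-+ (scale (size powerEnd)) (scale-+ rows
          (scale-+ (scale (size layersStart)) (scale-+ (scale-loopSteps n (scale-layer H≤N))
          (scale-+ (scale (size scanStart)) (scale-+ scans
          (scale-+ (scale (size outputStart)) (scale-+ output
          (scale-+ (scale (size outputNext)) output))))))))))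
    in total

-- Time and space as functions of n

module Budget (ℓ w : ℕ) (m : ℕ → ℕ) (pm : PolyBounded m) where

  -- The bound required by `Execution`, divided by 2ⁿ. The first two summands bound the encoded
  -- formula together with its length prefix, `n + 3` the tables, and `w + 4` the rest.
  magnitude : ℕ → ℕ
  magnitude n = 2 + m n * suc (w + w) + (n + 3 + (w + 4))

  V W : ℕ → ℕ
  V n = magnitude n * 2 ^ n
  W n = 2 ^ ℓ * V n

  width : ℕ → ℕ
  width n = suc (ℓ + (magnitude n + n))

  bits-W : ∀ n → bits (W n) ≤ width n
  bits-W n = s≤s (≤-trans (⌊log₂⌋-mono-≤ W≤) (≤-reflexive (⌊log₂[2^n]⌋≡n (ℓ + (magnitude n + n)))))
    where
    open ≤-Reasoning
    W≤ : W n ≤ 2 ^ (ℓ + (magnitude n + n))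
    W≤ = begin
      -- The crude `magnitude n ≤ 2 ^ magnitude n` suffices, because only the logarithm matters and
      -- it stays polynomial.
      2 ^ ℓ * (magnitude n * 2 ^ n)            ≤⟨ *-monoʳ-≤ (2 ^ ℓ) (*-monoˡ-≤ (2 ^ n) (n≤2^n (magnitude n))) ⟩
      2 ^ ℓ * (2 ^ magnitude n * 2 ^ n)        ≡⟨ cong (2 ^ ℓ *_) (^-distribˡ-+-* 2 (magnitude n) n) ⟨
      2 ^ ℓ * 2 ^ (magnitude n + n)            ≡⟨ ^-distribˡ-+-* 2 ℓ (magnitude n + n) ⟨
      2 ^ (ℓ + (magnitude n + n))              ∎

  poly-magnitude : PolyBounded magnitude
  poly-magnitude =
    let p = poly-+ (poly-+ (poly-const 2) (poly-* pm (poly-const (suc (w + w)))))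
              (poly-+ (poly-+ poly-id (poly-const 3)) (poly-const (w + 4)))
    in p

  poly-width : PolyBounded width
  poly-width = let p = poly-+ (poly-const 1) (poly-+ (poly-const ℓ) (poly-+ poly-magnitude poly-id)) in p

  -- The last factor of `time` is `Exec.β`; `memory` is `Exec.σ` for the 17 registers of the
  -- program.
  time memory : ℕ → ℕ
  time n   = steps n 1 1 w (m n) * 2 ^ n * (2 * bits (W n))
  memory n = (17 + W n) * bits (W n)

  time∈O* : time ∈O* (λ n → 2 ^ n)
  time∈O* =
    (λ n → steps n 1 1 w (m n) * (2 * width n)) ,
    poly-* (poly-steps w pm) (poly-* (poly-const 2) poly-width) ,
    λ n → ≤-trans (*-monoʳ-≤ (steps n 1 1 w (m n) * 2 ^ n) (*-monoʳ-≤ 2 (bits-W n)))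
      (≤-reflexive (swap (steps n 1 1 w (m n)) (2 ^ n) (2 * width n)))
    where
    swap : ∀ a b c → a * b * c ≡ a * c * b
    swap = solve-∀

  memory∈O* : memory ∈O* (λ n → 2 ^ n)
  memory∈O* =
    (λ n → (17 + 2 ^ ℓ * magnitude n) * width n) ,
    poly-* (poly-+ (poly-const 17) (poly-* (poly-const (2 ^ ℓ)) poly-magnitude)) poly-width ,
    bound
    where
    swap : ∀ a b c → a * b * c ≡ a * c * b
    swap = solve-∀
    bound : ∀ n → memory n ≤ (17 + 2 ^ ℓ * magnitude n) * width n * 2 ^ n
    bound n = begin
      (17 + W n) * bits (W n)
        ≤⟨ *-mono-≤ (+-mono-≤ (m≤m*n 17 (2 ^ n) {{m^n≢0 2 n}})
             (≤-reflexive (sym (*-assoc (2 ^ ℓ) (magnitude n) (2 ^ n))))) (bits-W n) ⟩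
      (17 * 2 ^ n + 2 ^ ℓ * magnitude n * 2 ^ n) * width n
        ≡⟨ cong (_* width n) (*-distribʳ-+ (2 ^ n) 17 (2 ^ ℓ * magnitude n)) ⟨
      (17 + 2 ^ ℓ * magnitude n) * 2 ^ n * width n
        ≡⟨ swap (17 + 2 ^ ℓ * magnitude n) (2 ^ n) (width n) ⟩
      (17 + 2 ^ ℓ * magnitude n) * width n * 2 ^ n ∎
      where open ≤-Reasoning

  V-large : ∀ {n} (F : CNF n) → IsKCNF w F → length F ≤ m n →
    suc (length (encodeCNF F)) + (n * 2 ^ n + (2 ^ n + (2 ^ n + 2 ^ n)) + (w + 4)) ≤ V n
  V-large {n} F F≤w F≤m = begin
    suc (length (encodeCNF F)) + (n * N + (N + (N + N)) + (w + 4))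
      ≤⟨ +-mono-≤ (≤-trans code≤ (*-identity≤ (2 + m n * suc (w + w))))
           (+-mono-≤ (≤-reflexive (collect n N)) (*-identity≤ (w + 4))) ⟩
    (2 + m n * suc (w + w)) * N + ((n + 3) * N + (w + 4) * N)
      ≡⟨ distribute (2 + m n * suc (w + w)) (n + 3) (w + 4) N ⟩
    V n ∎
    where
    open ≤-Reasoning
    N = 2 ^ n
    *-identity≤ : ∀ a → a ≤ a * N
    *-identity≤ a = m≤m*n a N {{m^n≢0 2 n}}
    code≤ : suc (length (encodeCNF F)) ≤ 2 + m n * suc (w + w)
    code≤ = s≤s (s≤s (≤-trans (length-encodeClauses F F≤w) (*-monoˡ-≤ (suc (w + w)) F≤m)))
    collect : ∀ n N → n * N + (N + (N + N)) ≡ (n + 3) * N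
    collect = solve-∀
    distribute : ∀ a b c N → a * N + (b * N + c * N) ≡ (a + (b + c)) * N
    distribute = solve-∀

  module _ (32≤ℓ : 32 ≤ ℓ) where

    module _ {n : ℕ} (F : CNF n) (F≤w : IsKCNF w F) (F≤m : length F ≤ m n) where

      open Correct F using (best)

      large-enough = V-large F F≤w F≤m

      module R = Exec.Run (Execution.run-program ℓ (V n) 32≤ℓ F F≤w large-enough)

      time≤ : R.time ≤ time n
      time≤ = ≤-trans R.time≤ (*-monoˡ-≤ (2 * bits (W n)) (≼⇒≤
        (scale-steps (m^n>0 2 n) n w (⌊n/2⌋≤n (2 ^ n)) F≤m)))

      output≡ : ∀ (z₁ z₂ : Assignment n) d → proj₂ best ≡ index z₁ → proj₁ best ≡ index z₂ + 2 ^ n * d →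
        output (Execution.final ℓ (V n) 32≤ℓ F F≤w large-enough) ≡ encodePair z₁ z₂
      output≡ z₁ z₂ d arg≡ val≡ = trans
        (output-writes (Execution.final ℓ (V n) 32≤ℓ F F≤w large-enough) n
          (Execution.M₂ ℓ (V n) 32≤ℓ F F≤w) (lowBits n (proj₂ best)) (lowBits n (proj₁ best))
          (length-lowBits n (proj₂ best)) (length-lowBits n (proj₁ best)) refl)
        (cong₂ _++_
          (trans (cong (lowBits n) (trans arg≡ (sym index≡))) (lowBits-index z₁ 0))
          (trans (cong (lowBits n) val≡) (lowBits-index z₂ d)))
        where
        index≡ : index z₁ + 2 ^ n * 0 ≡ index z₁
        index≡ = trans (cong (index z₁ +_) (*-zeroʳ (2 ^ n))) (+-identityʳ (index z₁))

    solve : ∀ (n : ℕ) (F : CNF n) → IsKCNF w F → length F ≤ m n → Satisfiable F →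
      Σ[ z₁ ∈ Assignment n ] Σ[ z₂ ∈ Assignment n ]
        z₁ ∈ Ω F × z₂ ∈ Ω F × d_H z₁ z₂ ≡ Diam F ×
        (∃[ t ] ∃[ p ]
          t ≤ time n × p ≤ memory n ×
          Runs diameterProgram (encodeCNF F) (encodePair z₁ z₂) t p)
    solve n F F≤w F≤m sat =
      let z₁ , z₂ , z₁∈ , z₂∈ , d≡ , arg≡ , val≡ = Correct.farthest F sat
      in z₁ , z₂ , z₁∈ , z₂∈ , d≡ ,
         _ , _ , time≤ F F≤w F≤m , R.peak≤ F F≤w F≤m ,
         _ , R.derivation F F≤w F≤m , output≡ F F≤w F≤m z₁ z₂ _ arg≡ val≡

theorem3 : ∀ (k : ℕ) →
    Σ[ P ∈ Program ]
    ∀ (m : ℕ → ℕ) → PolyBounded m →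
    Σ[ T ∈ (ℕ → ℕ) ] Σ[ S ∈ (ℕ → ℕ) ]
    T ∈O* (λ n → 2 ^ n) × S ∈O* (λ n → 2 ^ n) ×
    (∀ (n : ℕ) (F : CNF n) → IsKCNF k F → length F ≤ m n → Satisfiable F →
    Σ[ z₁ ∈ Assignment n ] Σ[ z₂ ∈ Assignment n ]
    z₁ ∈ Ω F × z₂ ∈ Ω F × d_H z₁ z₂ ≡ Diam F ×
    (∃[ t ] ∃[ p ]
    t ≤ T n × p ≤ S n × Runs P (encodeCNF F) (encodePair z₁ z₂) t p))
-- The 32 is a round number above the size of every loop-free block; the longest, `mixBody`, has
-- size 23. One program serves all `k`; `k` and `m` enter only the bounds.
theorem3 k = diameterProgram , λ m pm →
  let open Budget 32 k m pm in
  time , memory , time∈O* , memory∈O* , solve ≤-refl
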